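{- There is an absolute constant $C>0$ such that every graph $G=(V,E)$ with $n=|V|\ge 2$ vertices and maximum degree $\Delta$ satisfies $$\mathcal{R}(G)\;\ge\; C\cdot\frac{\sqrt{n}}{\Delta}\cdot\sqrt{\log n}.$$
   Context: Graphs are finite, undirected, simple and connected. A random walk on $G$ moves at each step from its current vertex to a neighbor chosen uniformly at random. The cover time $\mathsf{COV}(s)$ is the expected number of steps for the walk started at $s$ to visit all vertices, and $\mathsf{COV}(G)=\max_{s\in V}\mathsf{COV}(s)$. Randomized broadcast algorithm $\mathsf{RBA}$ (push algorithm): at time $0$ only a vertex $s$ knows a rumor; at each time step $t=1,2,\dots$ every vertex that knows the rumor chooses, independently, a neighbor uniformly at random and informs it. $I_t$ is the set of informed vertices at time $t$ ($I_0=\{s\}$). The expected broadcast time is $\mathbf{E}[\mathsf{RBA}(G)]:=\max_{s\in V}\mathbf{E}[\min\{t: I_t=V\}\text{ with } I_0=\{s\}]$. Finally $\mathcal{R}(G):=\mathsf{COV}(G)/\mathbf{E}[\mathsf{RBA}(G)]$. -}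

module Defs where

open import Algebra.Definitions.RawSemiring as RawSemiringDefs using ()
open import Data.Bool using (if_then_else_)
open import Data.Bool.Properties using () renaming (_≟_ to _≟ᵇ_)
open import Data.Fin using (Fin; zero; suc; _≤_)
open import Data.Fin.Properties using (_≟_; _≤?_; all?; any?)
open import Data.Fin.Subset using (Subset; ⁅_⁆; _∪_; ⋃) renaming (⊤ to full)
open import Data.Fin.Subset.Properties using (_∈?_)
open import Data.Integer using (+_)
open import Data.List using (List; []; _∷_; length; map; concatMap; filter; foldr; allFin; upTo)
open import Data.List.Extrema.Nat using (max)
open import Data.Nat using (ℕ; zero; suc; _!)
open import Data.Nat.Properties using (_!≢0)
open import Data.Product using (_×_; _,_; ∃-syntax)
open import Data.Rational as ℚ using (ℚ; 0ℚ; 1ℚ; _/_)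
open import Data.Sum using (_⊎_)
open import Data.Vec using (Vec; []; _∷_; lookup)
open import Data.Vec.Properties using (≡-dec)
open import Relation.Binary using (Decidable; Symmetric; Irreflexive)
open import Relation.Binary.Construct.Closure.ReflexiveTransitive using (Star)
open import Relation.Binary.PropositionalEquality using (_≡_)
open import Relation.Nullary using (Dec; does)
open import Relation.Nullary.Decidable using (_×-dec_)
import Relation.Unary as U

open RawSemiringDefs ℚ.+-*-rawSemiring using () renaming (_^_ to _^ℚ_)

record Graph (n : ℕ) : Set₁ where
  field
    Adj       : Fin n → Fin n → Set
    adj?      : Decidable Adj
    symmetric : Symmetric Adj
    loopless  : Irreflexive _≡_ Adj
    connected : ∀ u v → Star Adj u v

  neighbours : Fin n → List (Fin n)
  neighbours u = filter (adj? u) (allFin n)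

  degree : Fin n → ℕ
  degree u = length (neighbours u)

  maxDegree : ℕ
  maxDegree = max 0 (map degree (allFin n))

-- x ∈ [0,∞] is given by its lower cut {q : q < x} and upper cut {q : x < q}.
-- No axioms (in particular no locatedness) are imposed, so that the supremum of a sequence of rationals
-- exists without a rate of convergence; x = ∞ has an empty upper cut.

record ℝ≥0∞ : Set₁ where
  field
    below above : ℚ → Set

infix 4 _<ᵣ_ _ᵣ<_ _≥ᵣ_
infixl 7 _*ᵣ_ _÷ᵣ_

_<ᵣ_ : ℚ → ℝ≥0∞ → Set
q <ᵣ x = ℝ≥0∞.below x q

_ᵣ<_ : ℝ≥0∞ → ℚ → Set
x ᵣ< q = ℝ≥0∞.above x q

_≥ᵣ_ : ℝ≥0∞ → ℝ≥0∞ → Set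
x ≥ᵣ y = ∀ q → q <ᵣ y → q <ᵣ x

fromℚ : ℚ → ℝ≥0∞
fromℚ p = record { below = λ q → q ℚ.< p ; above = λ q → p ℚ.< q }

ℕ→ℚ : ℕ → ℚ
ℕ→ℚ n = + n / 1

fromℕ : ℕ → ℝ≥0∞
fromℕ n = fromℚ (ℕ→ℚ n)

sup : (ℕ → ℚ) → ℝ≥0∞
sup a = record
  { below = λ q → ∃[ N ] q ℚ.< a N
  ; above = λ q → ∃[ b ] b ℚ.< q × (∀ N → a N ℚ.≤ b)
  }

-- The maximum of a nonempty finite family.
maxᵣ : ∀ {n} → (Fin n → ℝ≥0∞) → ℝ≥0∞
maxᵣ x = record
  { below = λ q → ∃[ s ] q <ᵣ x s
  ; above = λ q → ∀ s → x s ᵣ< q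
  }

_*ᵣ_ : ℝ≥0∞ → ℝ≥0∞ → ℝ≥0∞
x *ᵣ y = record
  { below = λ q → q ℚ.< 0ℚ ⊎
      ∃[ a ] ∃[ b ] 0ℚ ℚ.≤ a × 0ℚ ℚ.≤ b × a <ᵣ x × b <ᵣ y × q ℚ.≤ a ℚ.* b
  ; above = λ q → ∃[ a ] ∃[ b ] x ᵣ< a × y ᵣ< b × a ℚ.* b ℚ.≤ q
  }

-- The quotient for x < ∞ and 0 < y < ∞.
_÷ᵣ_ : ℝ≥0∞ → ℝ≥0∞ → ℝ≥0∞
x ÷ᵣ y = record
  { below = λ q → ∃[ a ] ∃[ b ] a <ᵣ x × y ᵣ< b × q ℚ.* b ℚ.≤ a
  ; above = λ q → ∃[ a ] ∃[ b ] x ᵣ< a × 0ℚ ℚ.< b × b <ᵣ y × a ℚ.≤ q ℚ.* b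
  }

√_ : ℝ≥0∞ → ℝ≥0∞
√ x = record
  { below = λ q → q ℚ.< 0ℚ ⊎ q ℚ.* q <ᵣ x
  ; above = λ q → 0ℚ ℚ.< q × x ᵣ< q ℚ.* q
  }

sumℚ : List ℚ → ℚ
sumℚ = foldr ℚ._+_ 0ℚ

-- e^q = Σ q^k / k!, as the supremum of the partial sums; only meaningful for q ≥ 0.
exp : ℚ → ℝ≥0∞
exp q = sup λ N → sumℚ (map term (upTo N))
  where
  term : ℕ → ℚ
  term k = (q ^ℚ k) ℚ.* ((+ 1 / (k !)) {{k !≢0}})

-- The natural logarithm of n ≥ 1: q < log n iff e^q < n, and log n < q iff n < e^q.
log : ℕ → ℝ≥0∞
log n = record
  { below = λ q → q ℚ.< 0ℚ ⊎ exp q ᵣ< ℕ→ℚ n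
  ; above = λ q → 0ℚ ℚ.< q × ℕ→ℚ n <ᵣ exp q
  }

-- Outcomes with their weights; an outcome may be listed several times.
Dist : Set → Set
Dist A = List (A × ℚ)

return : ∀ {A} → A → Dist A
return x = (x , 1ℚ) ∷ []

infixl 1 _>>=_

_>>=_ : ∀ {A B} → Dist A → (A → Dist B) → Dist B
d >>= f = concatMap (λ (x , p) → map (λ (y , r) → y , p ℚ.* r) (f x)) d

-- The case [] never arises for the neighbours of a vertex of a connected graph with n ≥ 2.
uniform : ∀ {A} → List A → Dist A
uniform []         = []
uniform xs@(_ ∷ _) = map (λ x → x , + 1 / length xs) xs

independent : ∀ {A} → List (Dist A) → Dist (List A)
independent []       = return []
independent (d ∷ ds) = d >>= λ x → independent ds >>= λ xs → return (x ∷ xs)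

expectation : ∀ {A} → Dist A → (A → ℚ) → ℚ
expectation d f = sumℚ (map (λ (x , p) → p ℚ.* f x) d)

-- The joint law of the states at times 0, …, N - 1 of the chain started at x.
trajectory : ∀ {S} → (S → Dist S) → ∀ N → S → Dist (Vec S N)
trajectory step zero    x = return []
trajectory step (suc N) x =
  step x >>= λ y → trajectory step N y >>= λ ys → return (x ∷ ys)

-- The least t < N with P t, or N if there is none.
least : ∀ {N} {P : Fin N → Set} → U.Decidable P → ℕ
least {zero}  P? = 0
least {suc N} P? = if does (P? zero) then 0 else suc (least (λ t → P? (suc t)))

-- E[T] for T = min {t : P t}, as sup_N E[min(T, N)]. The event P t may depend on
-- the states up to time t, so min(T, N) is determined by the times 0, …, N - 1.
expectedTime : ∀ {S} → (S → Dist S) →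
               {P : ∀ {N} → Vec S N → Fin N → Set} →
               (∀ {N} (xs : Vec S N) → U.Decidable (P xs)) →
               S → ℝ≥0∞
expectedTime step P? x = sup λ N →
  expectation (trajectory step N x) (λ xs → ℕ→ℚ (least (P? xs)))

module _ {n : ℕ} where

  Covered : ∀ {N} → Vec (Fin n) N → Fin N → Set
  Covered xs t = ∀ v → ∃[ i ] i ≤ t × lookup xs i ≡ v

  covered? : ∀ {N} (xs : Vec (Fin n) N) → U.Decidable (Covered xs)
  covered? xs t = all? λ v → any? λ i → i ≤? t ×-dec lookup xs i ≟ v

  AllInformed : ∀ {N} → Vec (Subset n) N → Fin N → Set
  AllInformed Is t = lookup Is t ≡ full

  allInformed? : ∀ {N} (Is : Vec (Subset n) N) → U.Decidable (AllInformed Is)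
  allInformed? Is t = ≡-dec _≟ᵇ_ (lookup Is t) full

module _ {n : ℕ} (G : Graph n) where
  open Graph G

  walkStep : Fin n → Dist (Fin n)
  walkStep u = uniform (neighbours u)

  pushStep : Subset n → Dist (Subset n)
  pushStep I =
    independent (map walkStep (filter (_∈? I) (allFin n))) >>= λ vs →
    return (I ∪ ⋃ (map ⁅_⁆ vs))

  COV : ℝ≥0∞
  COV = maxᵣ λ s → expectedTime walkStep covered? s

  E[RBA] : ℝ≥0∞
  E[RBA] = maxᵣ λ s → expectedTime pushStep allInformed? ⁅ s ⁆

  𝓡 : ℝ≥0∞
  𝓡 = COV ÷ᵣ E[RBA]

{-# OPTIONS --safe #-}

-- Write D for the diameter, Δ for the maximum degree, and 2^L ≤ n < 2^(L+1).
--
-- Broadcasting takes O(Δ (D + L)) expected steps.  If d_v is the distance from the informed set to v, each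
-- step lowers d_v with probability at least 1/Δ, so Ψ = Σ_{v not informed} 2^(d_v - 1) shrinks on average by
-- the factor 1 - 1/(2Δ); it starts below n 2^D and is at least 1 until everybody is informed.
--
-- Covering takes Ω(n L + D²) expected steps.  Let H v x be the expected time from x to v and
-- κ(u,v) = H v u + H u v the commute time.  By reversibility H v u = (κ(u,v) + h v - h u) / 2 for a potential h,
-- and along the successive targets in Matthews' argument the h-terms telescope, so a set A with all commute
-- times at least 2K has cover time at least K (1 + 1/2 + ... + 1/(|A|-1)) from a vertex of A minimizing h.
-- Dirichlet's principle bounds κ(u,v) below by means of test functions: the indicator of u gives order n when u
-- has at most a constant times the average degree, and the distance to v gives 2 dist(u,v)².
--
-- Finally √(n L) (D + L) ≤ O(n L + D²).  All expectations are truncated at a finite time, as in the definition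
-- of expectedTime; a large enough horizon loses only a factor 2 in the lower bound.
module Submission where

open import Defs
open import Algebra.Bundles using (CommutativeRing)
open import Algebra.Definitions.RawSemiring as RawSemiringDefs using ()
import Algebra.Properties.CommutativeMonoid.Sum as CommutativeMonoidSum
import Algebra.Properties.Semiring.Sum as SemiringSum
open import Data.Bool using (Bool; true; false; if_then_else_)
open import Data.Fin as Fin using (Fin; zero; suc; toℕ; punchIn; punchOut)
open import Data.Fin.Properties as Fin using (any?; punchIn-punchOut; toℕ-fromℕ<; ¬∀⟶∃¬)
open import Data.Fin.Subset using (Subset; ⁅_⁆; _∪_; ⋃; _⊆_) renaming (⊤ to full; _∈_ to _∈ˢ_; _∉_ to _∉ˢ_)
open import Data.Fin.Subset.Properties using (p⊆p∪q; q⊆p∪q; x∈⁅x⁆; _∈?_; ⊆-antisym; ⊆⊤)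
import Data.Integer as ℤ
import Data.Integer.Properties as ℤ
open import Data.List as List using (List; []; _∷_; _++_; length; filter; allFin; tabulate; cartesianProduct)
import Data.List.Extrema as Extrema
open import Data.List.Extrema.Nat using (argmax; f[xs]≤f[argmax]; xs≤max)
open import Data.List.Membership.DecPropositional using () renaming (_∈?_ to member?)
open import Data.List.Membership.Propositional using (_∈_; _∉_)
open import Data.List.Membership.Propositional.Properties using (∈-filter⁺; ∈-filter⁻; ∈-allFin; ∈-cartesianProduct⁺; ∈-map⁺; ∈-upTo⁺)
open import Data.List.Properties using (map-tabulate; map-++; filter-all; filter-accept; filter-reject; length-filter)
open import Data.List.Relation.Unary.All as All using (All; []; _∷_)
open import Data.List.Relation.Unary.AllPairs using ([]; _∷_)
open import Data.List.Relation.Unary.Any using (here; there)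
open import Data.List.Relation.Unary.Unique.Propositional using (Unique)
import Data.List.Relation.Unary.Unique.Propositional.Properties as Unique
open import Data.Nat as ℕ using (ℕ; zero; suc; _!)
open import Data.Nat.Properties as ℕ using (_!≢0)
open import Data.Product using (_×_; _,_; ∃-syntax; proj₁; proj₂)
open import Data.Rational as ℚ using (ℚ; 0ℚ; 1ℚ; ½; _+_; _*_; _-_; -_; _/_; _≤_; _<_; mkℚ)
open import Data.Rational.Properties as ℚ using (≤-refl; ≤-trans; ≤-reflexive; <⇒≤; +-mono-≤)
open import Data.Rational.Unnormalised as ℚᵘ using (mkℚᵘ)
import Data.Rational.Unnormalised.Properties as ℚᵘ
open import Data.Sum using (_⊎_; inj₁; inj₂)
open import Data.Vec using (Vec; []; _∷_; lookup)
open import Function using (_∘_)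
open import Level using (0ℓ)
open import Relation.Binary.Bundles using (DecTotalOrder)
open import Relation.Binary.Construct.Closure.ReflexiveTransitive using (Star; ε; _◅_)
open import Relation.Binary.Definitions using (tri<; tri≈; tri>)
open import Relation.Binary.PropositionalEquality using (_≡_; _≢_; refl; sym; trans; cong; cong₂; subst; subst₂; ≢-sym; module ≡-Reasoning)
open import Relation.Nullary using (Dec; yes; no; contradiction; does)
open import Relation.Nullary.Decidable using (dec⇒maybe; dec-true; dec-false; _×-dec_; _⊎-dec_; ¬?)
import Relation.Unary as U
open import Tactic.RingSolver using (solve-∀)
open import Tactic.RingSolver.Core.AlmostCommutativeRing using (AlmostCommutativeRing; fromCommutativeRing)

open CommutativeMonoidSum ℚ.+-0-commutativeMonoid using (sum; ∑-distrib-+; ∑-comm; sum-cong-≗)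
open SemiringSum (CommutativeRing.semiring ℚ.+-*-commutativeRing) using (*-distribˡ-sum)
open RawSemiringDefs ℚ.+-*-rawSemiring using () renaming (_^_ to _^ℚ_)

-- `H v` is not introduced as an expectation. It is the rational solution of the first-step
-- equations, found by Gaussian elimination over `ℚ`; solvability follows from injectivity, which is
-- an energy argument. Commute times are then algebra in `H`, and contact with the walk is made only
-- through the one-step equation: a potential built from `H` is compared with the truncated cover
-- time by induction on the horizon. The broadcast bound is an induction on the horizon as well,
-- with functions affine in Ψ, so neither stopping times nor limits of expectations occur.
--
-- The quantities compared are cuts and not numbers. For each graph two rational thresholds are
-- fixed, `coverBound` below the cover time and `broadcastBound` above the broadcast time. Every
-- rational `q` below the right-hand side is shown to satisfy `q * broadcastBound ≤ coverBound`. The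
-- roots enter only through the squares of their rational approximants, which is all that an
-- inequality of the type 2xy ≤ x² + y² asks for.

ring : AlmostCommutativeRing 0ℓ 0ℓ
ring = fromCommutativeRing ℚ.+-*-commutativeRing (λ x → dec⇒maybe (0ℚ ℚ.≟ x))

-- The form of nearly every inequality below: the ring solver proves equations only, so the
-- difference of the two sides is written as a visibly nonnegative `c`, and what remains is an
-- identity.
≤-by : ∀ {a b} c → 0ℚ ≤ c → b ≡ a + c → a ≤ b
≤-by {a} {b} c 0≤c eq = subst₂ _≤_ (ℚ.+-identityʳ a) (sym eq) (ℚ.+-monoʳ-≤ a 0≤c)

0≤+ : ∀ {a b} → 0ℚ ≤ a → 0ℚ ≤ b → 0ℚ ≤ a + b
0≤+ = +-mono-≤

0≤* : ∀ {a b} → 0ℚ ≤ a → 0ℚ ≤ b → 0ℚ ≤ a * b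
0≤* {a} {b} 0≤a 0≤b = ℚ.nonNegative⁻¹ (a * b) {{ℚ.nonNeg*nonNeg⇒nonNeg a {{ℚ.nonNegative 0≤a}} b {{ℚ.nonNegative 0≤b}}}}

0<* : ∀ {a b} → 0ℚ < a → 0ℚ < b → 0ℚ < a * b
0<* {a} {b} 0<a 0<b = ℚ.positive⁻¹ (a * b) {{ℚ.pos*pos⇒pos a {{ℚ.positive 0<a}} b {{ℚ.positive 0<b}}}}

≤⇒0≤- : ∀ {a b} → a ≤ b → 0ℚ ≤ b - a
≤⇒0≤- {a} {b} a≤b = subst (_≤ b - a) (ℚ.+-inverseʳ a) (ℚ.+-monoˡ-≤ (- a) a≤b)

*-monoˡ-≤ : ∀ {r a b} → 0ℚ ≤ r → a ≤ b → r * a ≤ r * b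
*-monoˡ-≤ {r} 0≤r = ℚ.*-monoˡ-≤-nonNeg r {{ℚ.nonNegative 0≤r}}

*-monoʳ-≤ : ∀ {r a b} → 0ℚ ≤ r → a ≤ b → a * r ≤ b * r
*-monoʳ-≤ {r} 0≤r = ℚ.*-monoʳ-≤-nonNeg r {{ℚ.nonNegative 0≤r}}

*-cancelˡ-≤ : ∀ {r a b} → 0ℚ < r → r * a ≤ r * b → a ≤ b
*-cancelˡ-≤ {r} 0<r = ℚ.*-cancelˡ-≤-pos r {{ℚ.positive 0<r}}

0≤square : ∀ a → 0ℚ ≤ a * a
0≤square a with ℚ.≤-total 0ℚ a
... | inj₁ 0≤a = 0≤* 0≤a 0≤a
... | inj₂ a≤0 = subst (0ℚ ≤_) (neg-square a) (0≤* (ℚ.neg-antimono-≤ a≤0) (ℚ.neg-antimono-≤ a≤0))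
  where
  neg-square : ∀ a → - a * - a ≡ a * a
  neg-square = solve-∀ ring

0≤½ : 0ℚ ≤ ½
0≤½ = ℚ.nonNegative⁻¹ ½

0≤1 : 0ℚ ≤ 1ℚ
0≤1 = ℚ.nonNegative⁻¹ 1ℚ

0<1 : 0ℚ < 1ℚ
0<1 = ℚ.positive⁻¹ 1ℚ

p≤p+q : ∀ {p q} → 0ℚ ≤ q → p ≤ p + q
p≤p+q {q = q} 0≤q = ≤-by q 0≤q refl

toℚᵘ-ℕ→ℚ : ∀ n → ℚ.toℚᵘ (ℕ→ℚ n) ℚᵘ.≃ mkℚᵘ (ℤ.+ n) 0
toℚᵘ-ℕ→ℚ n = ℚ.toℚᵘ-fromℚᵘ (mkℚᵘ (ℤ.+ n) 0)

ℕ→ℚ-+ : ∀ m n → ℕ→ℚ (m ℕ.+ n) ≡ ℕ→ℚ m + ℕ→ℚ n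
ℕ→ℚ-+ m n = ℚ.toℚᵘ-injective (ℚᵘ.≃-trans (toℚᵘ-ℕ→ℚ (m ℕ.+ n)) (ℚᵘ.≃-sym
  (ℚᵘ.≃-trans (ℚ.toℚᵘ-homo-+ (ℕ→ℚ m) (ℕ→ℚ n)) (ℚᵘ.≃-trans (ℚᵘ.+-cong (toℚᵘ-ℕ→ℚ m) (toℚᵘ-ℕ→ℚ n))
  (ℚᵘ.*≡* (cong (ℤ._* ℤ.+ 1) (cong₂ ℤ._+_ (ℤ.*-identityʳ (ℤ.+ m)) (ℤ.*-identityʳ (ℤ.+ n)))))))))

ℕ→ℚ-suc : ∀ n → ℕ→ℚ (suc n) ≡ 1ℚ + ℕ→ℚ n
ℕ→ℚ-suc = ℕ→ℚ-+ 1

ℕ→ℚ-* : ∀ m n → ℕ→ℚ (m ℕ.* n) ≡ ℕ→ℚ m * ℕ→ℚ n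
ℕ→ℚ-* zero    n = sym (ℚ.*-zeroˡ (ℕ→ℚ n))
ℕ→ℚ-* (suc m) n = begin
  ℕ→ℚ (n ℕ.+ m ℕ.* n)            ≡⟨ ℕ→ℚ-+ n (m ℕ.* n) ⟩
  ℕ→ℚ n + ℕ→ℚ (m ℕ.* n)          ≡⟨ cong (ℕ→ℚ n +_) (ℕ→ℚ-* m n) ⟩
  ℕ→ℚ n + ℕ→ℚ m * ℕ→ℚ n          ≡⟨ distrib (ℕ→ℚ m) (ℕ→ℚ n) ⟩
  (1ℚ + ℕ→ℚ m) * ℕ→ℚ n           ≡⟨ cong (_* ℕ→ℚ n) (sym (ℕ→ℚ-suc m)) ⟩
  ℕ→ℚ (suc m) * ℕ→ℚ n            ∎
  where
  open ≡-Reasoning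
  distrib : ∀ x y → y + x * y ≡ (1ℚ + x) * y
  distrib = solve-∀ ring

0≤ℕ→ℚ : ∀ n → 0ℚ ≤ ℕ→ℚ n
0≤ℕ→ℚ n = ℚ.nonNegative⁻¹ (ℕ→ℚ n) {{ℚ.normalize-nonNeg n 1}}

ℕ→ℚ-mono-≤ : ∀ {m n} → m ℕ.≤ n → ℕ→ℚ m ≤ ℕ→ℚ n
ℕ→ℚ-mono-≤ {m} {n} m≤n = ≤-by (ℕ→ℚ (n ℕ.∸ m)) (0≤ℕ→ℚ (n ℕ.∸ m))
  (trans (cong ℕ→ℚ (sym (ℕ.m+[n∸m]≡n m≤n))) (ℕ→ℚ-+ m (n ℕ.∸ m)))

0<ℕ→ℚ-suc : ∀ n → 0ℚ < ℕ→ℚ (suc n)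
0<ℕ→ℚ-suc n = ℚ.positive⁻¹ (ℕ→ℚ (suc n)) {{ℚ.normalize-pos (suc n) 1}}

0<ℕ→ℚ : ∀ {n} → 0 ℕ.< n → 0ℚ < ℕ→ℚ n
0<ℕ→ℚ {suc n} _ = 0<ℕ→ℚ-suc n

ℕ→ℚ-mono-< : ∀ {m n} → m ℕ.< n → ℕ→ℚ m < ℕ→ℚ n
ℕ→ℚ-mono-< {m} {n} m<n = ℚ.<-≤-trans
  (subst₂ _<_ (ℚ.+-identityˡ (ℕ→ℚ m)) (sym (ℕ→ℚ-suc m)) (ℚ.+-monoˡ-< (ℕ→ℚ m) 0<1))
  (ℕ→ℚ-mono-≤ m<n)

ℕ→ℚ-cancel-≤ : ∀ {m n} → ℕ→ℚ m ≤ ℕ→ℚ n → m ℕ.≤ n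
ℕ→ℚ-cancel-≤ {m} {n} p with m ℕ.≤? n
... | yes m≤n = m≤n
... | no m≰n with () ← ℚ.<-irrefl refl (ℚ.<-≤-trans (ℕ→ℚ-mono-< (ℕ.≰⇒> m≰n)) p)

1/suc : ℕ → ℚ
1/suc k = ℤ.+ 1 / suc k

1/suc-inverse : ∀ k → 1/suc k * ℕ→ℚ (suc k) ≡ 1ℚ
1/suc-inverse k = ℚ.toℚᵘ-injective (ℚᵘ.≃-trans (ℚ.toℚᵘ-homo-* (1/suc k) (ℕ→ℚ (suc k)))
  (ℚᵘ.≃-trans (ℚᵘ.*-cong (ℚ.toℚᵘ-fromℚᵘ (mkℚᵘ (ℤ.+ 1) k)) (toℚᵘ-ℕ→ℚ (suc k)))
  (ℚᵘ.*≡* (cong ℤ.+_ lemma))))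
  where
  lemma : (suc k ℕ.+ 0) ℕ.* 1 ≡ suc (k ℕ.* 1 ℕ.+ 0)
  lemma = trans (ℕ.*-identityʳ _) (cong suc (cong (ℕ._+ 0) (sym (ℕ.*-identityʳ k))))

0<1/suc : ∀ k → 0ℚ < 1/suc k
0<1/suc k = ℚ.positive⁻¹ (1/suc k) {{ℚ.normalize-pos 1 (suc k)}}

0≤1/suc : ∀ k → 0ℚ ≤ 1/suc k
0≤1/suc k = <⇒≤ (0<1/suc k)

1/suc-antimono : ∀ {j k} → j ℕ.≤ k → 1/suc k ≤ 1/suc j
1/suc-antimono {j} {k} j≤k = *-cancelˡ-≤ (0<ℕ→ℚ-suc k) (*-cancelˡ-≤ (0<ℕ→ℚ-suc j) (begin
  J * (K * 1/suc k)  ≡⟨ swap (1/suc k) J K (1/suc-inverse k) ⟩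
  J                        ≤⟨ ℕ→ℚ-mono-≤ (ℕ.s≤s j≤k) ⟩
  K                        ≡⟨ sym (trans (comm J K (1/suc j)) (swap (1/suc j) K J (1/suc-inverse j))) ⟩
  J * (K * 1/suc j)  ∎))
  where
  open ℚ.≤-Reasoning
  J = ℕ→ℚ (suc j)
  K = ℕ→ℚ (suc k)
  rearrange : ∀ r x y → x * (y * r) ≡ x * (r * y)
  rearrange = solve-∀ ring
  comm : ∀ x y r → x * (y * r) ≡ y * (x * r)
  comm = solve-∀ ring
  swap : ∀ r x y → r * y ≡ 1ℚ → x * (y * r) ≡ x
  swap r x y e = trans (rearrange r x y) (trans (cong (x *_) e) (ℚ.*-identityʳ x))

ℚ-archimedean : ∀ q → ∃[ N ] q ≤ ℕ→ℚ N
ℚ-archimedean q@(mkℚ i d _) = ℤ.∣ i ∣ , ℚ.toℚᵘ-cancel-≤ (ℚᵘ.≤-trans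
  (ℚᵘ.*≤* bound) (ℚᵘ.≤-reflexive (ℚᵘ.≃-sym (toℚᵘ-ℕ→ℚ ℤ.∣ i ∣))))
  where
  i≤∣i∣ : ∀ i → i ℤ.≤ ℤ.+ ℤ.∣ i ∣
  i≤∣i∣ (ℤ.+ _)     = ℤ.≤-refl
  i≤∣i∣ ℤ.-[1+ _ ] = ℤ.-≤+
  bound : i ℤ.* ℤ.+ 1 ℤ.≤ ℤ.+ ℤ.∣ i ∣ ℤ.* ℤ.+ suc d
  bound = ℤ.≤-trans (ℤ.≤-reflexive (ℤ.*-identityʳ i)) (ℤ.≤-trans (i≤∣i∣ i)
    (subst (ℤ.+ ℤ.∣ i ∣ ℤ.≤_) (ℤ.pos-* ℤ.∣ i ∣ (suc d)) (ℤ.+≤+ (ℕ.m≤m*n ℤ.∣ i ∣ (suc d)))))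

-- Finite sums of rationals

∑-scale : ∀ {n} c (f : Fin n → ℚ) → sum (λ i → c * f i) ≡ c * sum f
∑-scale c f = sym (*-distribˡ-sum c f)

∑-zero : ∀ {n} {f : Fin n → ℚ} → (∀ i → f i ≡ 0ℚ) → sum f ≡ 0ℚ
∑-zero {zero}      f≡0 = refl
∑-zero {suc n} {f} f≡0 = cong₂ _+_ (f≡0 zero) (∑-zero (f≡0 ∘ suc))

∑-neg : ∀ {n} (f : Fin n → ℚ) → sum (λ i → - f i) ≡ - sum f
∑-neg {zero}  f = refl
∑-neg {suc n} f = trans (cong (- f zero +_) (∑-neg (f ∘ suc))) (sym (ℚ.neg-distrib-+ (f zero) _))

∑-sub : ∀ {n} (f g : Fin n → ℚ) → sum (λ i → f i - g i) ≡ sum f - sum g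
∑-sub f g = trans (∑-distrib-+ f (λ i → - g i)) (cong (sum f +_) (∑-neg g))

∑-mono-≤ : ∀ {n} {f g : Fin n → ℚ} → (∀ i → f i ≤ g i) → sum f ≤ sum g
∑-mono-≤ {zero}  f≤g = ≤-refl
∑-mono-≤ {suc n} f≤g = +-mono-≤ (f≤g zero) (∑-mono-≤ (f≤g ∘ suc))

∑-nonneg : ∀ {n} {f : Fin n → ℚ} → (∀ i → 0ℚ ≤ f i) → 0ℚ ≤ sum f
∑-nonneg {zero}  0≤f = ≤-refl
∑-nonneg {suc n} 0≤f = 0≤+ (0≤f zero) (∑-nonneg (0≤f ∘ suc))

term≤∑ : ∀ {n} {f : Fin n → ℚ} → (∀ i → 0ℚ ≤ f i) → ∀ i → f i ≤ sum f
term≤∑ {suc n}     0≤f zero    = p≤p+q (∑-nonneg (0≤f ∘ suc))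
term≤∑ {suc n} {f} 0≤f (suc i) = ≤-trans (term≤∑ (0≤f ∘ suc) i) (≤-by (f zero) (0≤f zero) (ℚ.+-comm (f zero) _))

∑-const : ∀ n c → sum {n} (λ _ → c) ≡ ℕ→ℚ n * c
∑-const zero    c = sym (ℚ.*-zeroˡ c)
∑-const (suc n) c = trans (cong (c +_) (∑-const n c)) (trans (distrib c (ℕ→ℚ n)) (cong (_* c) (sym (ℕ→ℚ-suc n))))
  where
  distrib : ∀ x y → x + y * x ≡ (1ℚ + y) * x
  distrib = solve-∀ ring

-- Gaussian elimination

Matrix : ℕ → ℕ → Set
Matrix m n = Fin m → Fin n → ℚ

infixr 8 _·_

_·_ : ∀ {m n} → Matrix m n → (Fin n → ℚ) → Fin m → ℚ
(A · x) i = sum λ j → A i j * x j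

infixr 5 _∷ᶠ_

_∷ᶠ_ : ∀ {n} → ℚ → (Fin n → ℚ) → Fin (suc n) → ℚ
(a ∷ᶠ x) zero    = a
(a ∷ᶠ x) (suc i) = x i

nonzeroEntry? : ∀ {n} (f : Fin n → ℚ) → (∃[ i ] f i ≢ 0ℚ) ⊎ (∀ i → f i ≡ 0ℚ)
nonzeroEntry? {zero}  f = inj₂ λ ()
nonzeroEntry? {suc n} f with f zero ℚ.≟ 0ℚ
... | no  f₀≢0 = inj₁ (zero , f₀≢0)
... | yes f₀≡0 with nonzeroEntry? (f ∘ suc)
...   | inj₁ (i , fᵢ≢0) = inj₁ (suc i , fᵢ≢0)
...   | inj₂ f≡0        = inj₂ λ { zero → f₀≡0 ; (suc i) → f≡0 i }

-- Row `p` holds the pivot of the first column and `r` is its inverse. `punchIn p` enumerates the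
-- other rows, so no rows are swapped; `reduced` is the Schur complement of the pivot.
module Elimination {n : ℕ} (A : Matrix (suc n) (suc n)) (p : Fin (suc n)) (r : ℚ) (inverse : r * A p zero ≡ 1ℚ) where

  reduced : Matrix n n
  reduced i j = A (punchIn p i) (suc j) - A (punchIn p i) zero * (r * A p (suc j))

  pivotValue : ℚ → (Fin n → ℚ) → ℚ
  pivotValue b y = r * (b - sum λ j → A p (suc j) * y j)

  pivotRow : ∀ b y → (A · (pivotValue b y ∷ᶠ y)) p ≡ b
  pivotRow b y = trans (identity (A p zero) r b (sum λ j → A p (suc j) * y j))
    (trans (cong (λ e → e * (b - S) + S) inverse) (cancel b S))
    where
    S = sum λ j → A p (suc j) * y j
    identity : ∀ a r b S → a * (r * (b - S)) + S ≡ (r * a) * (b - S) + S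
    identity = solve-∀ ring
    cancel : ∀ b S → 1ℚ * (b - S) + S ≡ b
    cancel = solve-∀ ring

  otherRow : ∀ b y i → (A · (pivotValue b y ∷ᶠ y)) (punchIn p i) ≡ (reduced · y) i + A (punchIn p i) zero * (r * b)
  otherRow b y i = sym (begin
    (reduced · y) i + a * (r * b)                  ≡⟨ cong (_+ a * (r * b)) expand ⟩
    (T - a * r * S) + a * (r * b)                  ≡⟨ identity a r b S T ⟩
    a * (r * (b - S)) + T                          ∎)
    where
    open ≡-Reasoning
    a = A (punchIn p i) zero
    S = sum λ j → A p (suc j) * y j
    T = sum λ j → A (punchIn p i) (suc j) * y j
    identity : ∀ a r b S T → (T - a * r * S) + a * (r * b) ≡ a * (r * (b - S)) + T
    identity = solve-∀ ring
    termwise : ∀ a r s t y → (t - a * (r * s)) * y ≡ t * y - a * r * (s * y)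
    termwise = solve-∀ ring
    expand : (reduced · y) i ≡ T - a * r * S
    expand = trans (sum-cong-≗ (λ j → termwise a r (A p (suc j)) (A (punchIn p i) (suc j)) (y j)))
      (trans (∑-sub (λ j → A (punchIn p i) (suc j) * y j) (λ j → a * r * (A p (suc j) * y j)))
      (cong (λ e → T - e) (∑-scale (a * r) (λ j → A p (suc j) * y j))))

  byRows : ∀ (P : Fin (suc n) → Set) → P p → (∀ i → P (punchIn p i)) → ∀ i → P i
  byRows P Pp Pother i with p Fin.≟ i
  ... | yes refl = Pp
  ... | no  p≢i  = subst P (punchIn-punchOut p≢i) (Pother (punchOut p≢i))

-- A Fredholm alternative, constructive because equality with 0 is decidable in `ℚ`. Kernel vectors
-- and solutions of the reduced system lift by back substitution through `pivotValue`; a zero first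
-- column makes the first unit vector a kernel vector.
singular-or-surjective : ∀ n (A : Matrix n n) →
  (∃[ x ] (∃[ j ] x j ≢ 0ℚ) × (∀ i → (A · x) i ≡ 0ℚ)) ⊎ (∀ (b : Fin n → ℚ) → ∃[ x ] (∀ i → (A · x) i ≡ b i))
singular-or-surjective zero    A = inj₂ λ b → b , λ ()
singular-or-surjective (suc n) A with nonzeroEntry? (λ i → A i zero)
... | inj₂ column≡0 = inj₁ ((1ℚ ∷ᶠ λ _ → 0ℚ) , (zero , λ ()) , λ i →
        cong₂ _+_ (trans (ℚ.*-identityʳ _) (column≡0 i)) (∑-zero (λ j → ℚ.*-zeroʳ (A i (suc j)))))
... | inj₁ (p , pivot≢0) = reduce (singular-or-surjective n reduced)
  where
  instance
    nonZero : ℚ.NonZero (A p zero)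
    nonZero = ℚ.≢-nonZero pivot≢0
  r : ℚ
  r = ℚ.1/ A p zero
  open Elimination A p r (ℚ.*-inverseˡ (A p zero))
  zeros : ∀ a r → 0ℚ + a * (r * 0ℚ) ≡ 0ℚ
  zeros = solve-∀ ring
  restore : ∀ a b → b - a + a ≡ b
  restore = solve-∀ ring
  reduce : _ → _
  reduce (inj₁ (y , (j , yⱼ≢0) , Ay≡0)) = inj₁ ((pivotValue 0ℚ y ∷ᶠ y) , (suc j , yⱼ≢0) ,
    byRows _ (pivotRow 0ℚ y) λ i →
      trans (otherRow 0ℚ y i) (trans (cong (_+ A (punchIn p i) zero * (r * 0ℚ)) (Ay≡0 i)) (zeros (A (punchIn p i) zero) r)))
  reduce (inj₂ solve) = inj₂ λ b →
    let b′ = λ i → b (punchIn p i) - A (punchIn p i) zero * (r * b p)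
        y , Ay≡b′ = solve b′
    in (pivotValue (b p) y ∷ᶠ y) , byRows _ (pivotRow (b p) y) λ i →
      trans (otherRow (b p) y i) (trans (cong (_+ A (punchIn p i) zero * (r * b p)) (Ay≡b′ i))
        (restore (A (punchIn p i) zero * (r * b p)) (b (punchIn p i))))

-- Indicators, filtered sums and double sums

indicator : Bool → ℚ
indicator b = if b then 1ℚ else 0ℚ

0≤indicator : ∀ b → 0ℚ ≤ indicator b
0≤indicator false = ≤-refl
0≤indicator true  = 0≤1

indicator≤1 : ∀ b → indicator b ≤ 1ℚ
indicator≤1 false = 0≤1
indicator≤1 true  = ≤-refl

sumℚ-filter : ∀ {A : Set} {P : A → Set} (P? : U.Decidable P) (f : A → ℚ) xs →
              sumℚ (List.map f (filter P? xs)) ≡ sumℚ (List.map (λ x → indicator (does (P? x)) * f x) xs)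
sumℚ-filter P? f []       = refl
sumℚ-filter P? f (x ∷ xs) with does (P? x)
... | true  = cong₂ _+_ (sym (ℚ.*-identityˡ (f x))) (sumℚ-filter P? f xs)
... | false = trans (sumℚ-filter P? f xs) (trans (sym (ℚ.+-identityˡ _)) (cong (_+ _) (sym (ℚ.*-zeroˡ (f x)))))

sumℚ-tabulate : ∀ {n} (f : Fin n → ℚ) → sumℚ (tabulate f) ≡ sum f
sumℚ-tabulate {zero}  f = refl
sumℚ-tabulate {suc n} f = cong (f zero +_) (sumℚ-tabulate (f ∘ suc))

sumℚ-filter-allFin : ∀ {n} {P : Fin n → Set} (P? : U.Decidable P) (f : Fin n → ℚ) →
                     sumℚ (List.map f (filter P? (allFin n))) ≡ sum (λ x → indicator (does (P? x)) * f x)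
sumℚ-filter-allFin {n} P? f = trans (sumℚ-filter P? f (allFin n))
  (trans (cong sumℚ (map-tabulate (λ x → x) (λ x → indicator (does (P? x)) * f x)))
         (sumℚ-tabulate (λ x → indicator (does (P? x)) * f x)))

sumℚ-const : ∀ {A : Set} c (xs : List A) → sumℚ (List.map (λ _ → c) xs) ≡ ℕ→ℚ (length xs) * c
sumℚ-const c []       = sym (ℚ.*-zeroˡ c)
sumℚ-const c (x ∷ xs) = trans (cong (c +_) (sumℚ-const c xs))
  (trans (distrib c (ℕ→ℚ (length xs))) (cong (_* c) (sym (ℕ→ℚ-suc (length xs)))))
  where
  distrib : ∀ x y → x + y * x ≡ (1ℚ + y) * x
  distrib = solve-∀ ring

δ : ∀ {n} → Fin n → Fin n → ℚ
δ x y = indicator (does (x Fin.≟ y))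

δ-same : ∀ {n} (x : Fin n) → δ x x ≡ 1ℚ
δ-same x = cong indicator (dec-true (x Fin.≟ x) refl)

δ-distinct : ∀ {n} {x y : Fin n} → x ≢ y → δ x y ≡ 0ℚ
δ-distinct {x = x} {y} x≢y = cong indicator (dec-false (x Fin.≟ y) x≢y)

∑-δ : ∀ {n} (x : Fin n) (f : Fin n → ℚ) → sum (λ y → δ x y * f y) ≡ f x
∑-δ {suc n} zero    f = trans (cong₂ _+_ (ℚ.*-identityˡ (f zero)) (∑-zero (λ i → ℚ.*-zeroˡ (f (suc i))))) (ℚ.+-identityʳ (f zero))
∑-δ {suc n} (suc x) f = trans (cong₂ _+_ (ℚ.*-zeroˡ (f zero)) (∑-δ x (f ∘ suc))) (ℚ.+-identityˡ (f (suc x)))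

square≡0⇒≡0 : ∀ p → p * p ≡ 0ℚ → p ≡ 0ℚ
square≡0⇒≡0 p p²≡0 with ℚ.<-cmp p 0ℚ
... | tri≈ _ p≡0 _ = p≡0
... | tri> _ _ 0<p = contradiction (sym p²≡0) (ℚ.<⇒≢ (0<* 0<p 0<p))
... | tri< p<0 _ _ = contradiction (sym (trans (neg-square p) p²≡0)) (ℚ.<⇒≢ (0<* 0<-p 0<-p))
  where
  0<-p : 0ℚ < - p
  0<-p = ℚ.neg-antimono-< p<0
  neg-square : ∀ a → - a * - a ≡ a * a
  neg-square = solve-∀ ring

p-q≡0⇒p≡q : ∀ {p q} → p - q ≡ 0ℚ → p ≡ q
p-q≡0⇒p≡q {p} {q} e = trans (restore p q) (trans (cong (_+ q) e) (ℚ.+-identityˡ q))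
  where
  restore : ∀ p q → p ≡ (p - q) + q
  restore = solve-∀ ring

double-injective : ∀ {p q} → p + p ≡ q + q → p ≡ q
double-injective {p} {q} e = trans (halve p) (trans (cong (½ *_) e) (sym (halve q)))
  where
  halve : ∀ p → p ≡ ½ * (p + p)
  halve = solve-∀ ring

∑∑ : ∀ {n} → (Fin n → Fin n → ℚ) → ℚ
∑∑ t = sum λ x → sum (t x)

∑∑-cong : ∀ {n} {s t : Fin n → Fin n → ℚ} → (∀ x y → s x y ≡ t x y) → ∑∑ s ≡ ∑∑ t
∑∑-cong e = sum-cong-≗ λ x → sum-cong-≗ (e x)

∑∑-+ : ∀ {n} (s t : Fin n → Fin n → ℚ) → ∑∑ (λ x y → s x y + t x y) ≡ ∑∑ s + ∑∑ t
∑∑-+ s t = trans (sum-cong-≗ (λ x → ∑-distrib-+ (s x) (t x))) (∑-distrib-+ (λ x → sum (s x)) (λ x → sum (t x)))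

∑∑-scale : ∀ {n} c (t : Fin n → Fin n → ℚ) → ∑∑ (λ x y → c * t x y) ≡ c * ∑∑ t
∑∑-scale c t = trans (sum-cong-≗ (λ x → ∑-scale c (t x))) (∑-scale c (λ x → sum (t x)))

∑∑-nonneg : ∀ {n} {t : Fin n → Fin n → ℚ} → (∀ x y → 0ℚ ≤ t x y) → 0ℚ ≤ ∑∑ t
∑∑-nonneg 0≤t = ∑-nonneg λ x → ∑-nonneg (0≤t x)

-- Potential theory on a connected graph

module Potential {n : ℕ} (G : Graph n) where
  open Graph G

  a : Fin n → Fin n → ℚ
  a x y = indicator (does (adj? x y))

  0≤a : ∀ x y → 0ℚ ≤ a x y
  0≤a x y = 0≤indicator (does (adj? x y))

  a-adj : ∀ {x y} → Adj x y → a x y ≡ 1ℚ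
  a-adj {x} {y} xy = cong indicator (dec-true (adj? x y) xy)

  a-sym : ∀ x y → a y x ≡ a x y
  a-sym x y with adj? x y
  ... | yes xy  = a-adj (symmetric xy)
  ... | no  ¬xy = cong indicator (dec-false (adj? y x) (¬xy ∘ symmetric))

  deg : Fin n → ℚ
  deg x = sum (a x)

  volume : ℚ
  volume = sum deg

  -- The Laplacian without division by the degree: it is symmetric for `⟨_,_⟩`, and the first-step
  -- equation of a hitting time reads `L H = deg`.
  L : (Fin n → ℚ) → Fin n → ℚ
  L f x = sum λ y → a x y * (f x - f y)

  ⟨_,_⟩ : (Fin n → ℚ) → (Fin n → ℚ) → ℚ
  ⟨ f , g ⟩ = sum λ x → f x * g x

  -- Ordered pairs are summed, so every edge counts twice; hence the doubled terms in `green` and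
  -- `dirichlet`.
  energy : (Fin n → ℚ) → (Fin n → ℚ) → ℚ
  energy f g = ∑∑ λ x y → a x y * ((f x - f y) * (g x - g y))

  -- Exchange the two summation variables in one copy of the double sum and use that `a` is
  -- symmetric.
  green : ∀ f g → ⟨ f , L g ⟩ + ⟨ f , L g ⟩ ≡ energy f g
  green f g = begin
    ⟨ f , L g ⟩ + ⟨ f , L g ⟩                 ≡⟨ cong₂ _+_ unfold (trans unfold (∑-comm t)) ⟩
    ∑∑ t + ∑∑ (λ x y → t y x)                 ≡⟨ sym (∑∑-+ t (λ x y → t y x)) ⟩
    ∑∑ (λ x y → t x y + t y x)                ≡⟨ ∑∑-cong symmetrize ⟩
    energy f g                                ∎
    where
    open ≡-Reasoning
    t : Fin n → Fin n → ℚ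
    t x y = f x * (a x y * (g x - g y))
    unfold : ⟨ f , L g ⟩ ≡ ∑∑ t
    unfold = sum-cong-≗ λ x → sym (∑-scale (f x) (λ y → a x y * (g x - g y)))
    identity : ∀ c p q r s → p * (c * (r - s)) + q * (c * (s - r)) ≡ c * ((p - q) * (r - s))
    identity = solve-∀ ring
    symmetrize : ∀ x y → t x y + t y x ≡ a x y * ((f x - f y) * (g x - g y))
    symmetrize x y = trans (cong (λ c → t x y + f y * (c * (g y - g x))) (a-sym x y))
                           (identity (a x y) (f x) (f y) (g x) (g y))

  energy-comm : ∀ f g → energy f g ≡ energy g f
  energy-comm f g = ∑∑-cong λ x y → cong (a x y *_) (ℚ.*-comm (f x - f y) (g x - g y))

  0≤energy : ∀ f → 0ℚ ≤ energy f f
  0≤energy f = ∑∑-nonneg λ x y → 0≤* (0≤a x y) (0≤square (f x - f y))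

  ∑L≡0 : ∀ f → sum (L f) ≡ 0ℚ
  ∑L≡0 f = double-injective (trans (cong₂ _+_ (sym one) (sym one)) (trans (green (λ _ → 1ℚ) f)
    (∑-zero (λ x → ∑-zero (λ y → vanish (a x y) (f x - f y))))))
    where
    one : ⟨ (λ _ → 1ℚ) , L f ⟩ ≡ sum (L f)
    one = sum-cong-≗ λ x → ℚ.*-identityˡ (L f x)
    vanish : ∀ c d → c * ((1ℚ - 1ℚ) * d) ≡ 0ℚ
    vanish = solve-∀ ring

  L-expand : ∀ f x → L f x ≡ deg x * f x - sum (λ y → a x y * f y)
  L-expand f x = trans (sum-cong-≗ (λ y → distrib (f x) (a x y) (f y)))
    (trans (∑-sub (λ y → f x * a x y) (λ y → a x y * f y))
           (cong (_- sum (λ y → a x y * f y)) (trans (∑-scale (f x) (a x)) (ℚ.*-comm (f x) (deg x)))))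
    where
    distrib : ∀ p c q → c * (p - q) ≡ p * c - c * q
    distrib = solve-∀ ring

  L-sub : ∀ f g x → L (λ y → f y - g y) x ≡ L f x - L g x
  L-sub f g x = trans (sum-cong-≗ (λ y → identity (a x y) (f x) (f y) (g x) (g y)))
    (∑-sub (λ y → a x y * (f x - f y)) (λ y → a x y * (g x - g y)))
    where
    identity : ∀ c p q r s → c * ((p - r) - (q - s)) ≡ c * (p - q) - c * (r - s)
    identity = solve-∀ ring

  -- A vanishing sum of nonnegative terms has only zero terms, so `f` agrees along every edge, and
  -- connectedness supplies a walk from `x` to `y`.
  harmonic⇒constant : ∀ f → energy f f ≡ 0ℚ → ∀ x y → f x ≡ f y
  harmonic⇒constant f E≡0 x y = along (connected x y)
    where
    0≤term : ∀ x y → 0ℚ ≤ a x y * ((f x - f y) * (f x - f y))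
    0≤term x y = 0≤* (0≤a x y) (0≤square (f x - f y))
    term≤E : ∀ x y → a x y * ((f x - f y) * (f x - f y)) ≤ energy f f
    term≤E x y = ≤-trans (term≤∑ (0≤term x) y) (term≤∑ (λ z → ∑-nonneg (0≤term z)) x)
    edge : ∀ {x y} → Adj x y → f x ≡ f y
    edge {x} {y} xy = p-q≡0⇒p≡q (square≡0⇒≡0 (f x - f y) (trans (sym (ℚ.*-identityˡ _))
      (trans (cong (_* ((f x - f y) * (f x - f y))) (sym (a-adj xy)))
             (ℚ.≤-antisym (subst (a x y * ((f x - f y) * (f x - f y)) ≤_) E≡0 (term≤E x y)) (0≤term x y)))))
    along : ∀ {x y} → Star Adj x y → f x ≡ f y
    along ε        = refl
    along (xy ◅ p) = trans (edge xy) (along p)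

  module _ (v : Fin n) where

    -- The Laplacian itself is singular, as it kills constants. A unit row at `v` builds in the
    -- condition on the value at `v` and keeps the system square.
    groundedMatrix : Matrix n n
    groundedMatrix x y = if does (x Fin.≟ v) then δ v y else deg x * δ x y - a x y

    groundedMatrix-ground : ∀ f → (groundedMatrix · f) v ≡ f v
    groundedMatrix-ground f with does (v Fin.≟ v) | dec-true (v Fin.≟ v) refl
    ... | true | refl = ∑-δ v f

    groundedMatrix-off : ∀ f {x} → x ≢ v → (groundedMatrix · f) x ≡ L f x
    groundedMatrix-off f {x} x≢v with does (x Fin.≟ v) | dec-false (x Fin.≟ v) x≢v
    ... | false | refl = begin
      sum (λ y → (deg x * δ x y - a x y) * f y)                ≡⟨ sum-cong-≗ (λ y → distrib (deg x) (δ x y) (a x y) (f y)) ⟩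
      sum (λ y → deg x * (δ x y * f y) - a x y * f y)          ≡⟨ ∑-sub (λ y → deg x * (δ x y * f y)) (λ y → a x y * f y) ⟩
      sum (λ y → deg x * (δ x y * f y)) - sum (λ y → a x y * f y)
                                                               ≡⟨ cong (_- sum (λ y → a x y * f y)) (trans (∑-scale (deg x) (λ y → δ x y * f y)) (cong (deg x *_) (∑-δ x f))) ⟩
      deg x * f x - sum (λ y → a x y * f y)                    ≡⟨ sym (L-expand f x) ⟩
      L f x                                                    ∎
      where
      open ≡-Reasoning
      distrib : ∀ d e c p → (d * e - c) * p ≡ d * (e * p) - c * p
      distrib = solve-∀ ring

    -- The product `f x * L f x` vanishes everywhere: at `v` because `f v` is 0, elsewhere because
    -- `L f x` is. So `f` has no energy and equals its value at `v` throughout.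
    grounded-injective : ∀ f → (∀ x → (groundedMatrix · f) x ≡ 0ℚ) → ∀ x → f x ≡ 0ℚ
    grounded-injective f Af≡0 x = trans (harmonic⇒constant f E≡0 x v) fv≡0
      where
      fv≡0 : f v ≡ 0ℚ
      fv≡0 = trans (sym (groundedMatrix-ground f)) (Af≡0 v)
      term≡0 : ∀ x → f x * L f x ≡ 0ℚ
      term≡0 x with x Fin.≟ v
      ... | yes refl = trans (cong (_* L f v) fv≡0) (ℚ.*-zeroˡ (L f v))
      ... | no  x≢v  = trans (cong (f x *_) (trans (sym (groundedMatrix-off f x≢v)) (Af≡0 x))) (ℚ.*-zeroʳ (f x))
      E≡0 : energy f f ≡ 0ℚ
      E≡0 = trans (sym (green f f)) (cong₂ _+_ (∑-zero term≡0) (∑-zero term≡0))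

    abstract

      -- First-step analysis, with the equation at `x` multiplied by its degree. Injectivity rules
      -- out the singular alternative, so elimination delivers a solution.
      hittingTime : ∃[ H ] (H v ≡ 0ℚ × (∀ {x} → x ≢ v → L H x ≡ deg x))
      hittingTime with singular-or-surjective n groundedMatrix
      ... | inj₁ (f , (x , fx≢0) , Af≡0) = contradiction (grounded-injective f Af≡0 x) fx≢0
      ... | inj₂ solve = let H , AH≡b = solve b in
            H , trans (sym (groundedMatrix-ground H)) (trans (AH≡b v) b-ground) ,
            λ x≢v → trans (sym (groundedMatrix-off H x≢v)) (trans (AH≡b _) (b-off x≢v))
        where
        b : Fin n → ℚ
        b x = if does (x Fin.≟ v) then 0ℚ else deg x
        b-ground : b v ≡ 0ℚ
        b-ground rewrite dec-true (v Fin.≟ v) refl = refl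
        b-off : ∀ {x} → x ≢ v → b x ≡ deg x
        b-off {x} x≢v rewrite dec-false (x Fin.≟ v) x≢v = refl

  H : Fin n → Fin n → ℚ
  H v = proj₁ (hittingTime v)

  H-target : ∀ v → H v v ≡ 0ℚ
  H-target v = proj₁ (proj₂ (hittingTime v))

  H-off : ∀ v {x} → x ≢ v → L (H v) x ≡ deg x
  H-off v = proj₂ (proj₂ (hittingTime v))

  -- The factor f x - f v hides the unknown value of L (H v) at v.
  ⟨-,LH⟩ : ∀ f v → ⟨ f , L (H v) ⟩ ≡ ⟨ f , deg ⟩ - volume * f v
  ⟨-,LH⟩ f v = begin
    ⟨ f , L (H v) ⟩                              ≡⟨ sym (trans (cong (λ e → ⟨ f , L (H v) ⟩ - f v * e) (∑L≡0 (H v))) (drop _ (f v))) ⟩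
    ⟨ f , L (H v) ⟩ - f v * sum (L (H v))        ≡⟨ sym (recentre (L (H v))) ⟩
    ⟨ (λ x → f x - f v) , L (H v) ⟩              ≡⟨ sum-cong-≗ agree ⟩
    ⟨ (λ x → f x - f v) , deg ⟩                  ≡⟨ recentre deg ⟩
    ⟨ f , deg ⟩ - f v * volume                   ≡⟨ cong (λ e → ⟨ f , deg ⟩ - e) (ℚ.*-comm (f v) volume) ⟩
    ⟨ f , deg ⟩ - volume * f v                   ∎
    where
    open ≡-Reasoning
    drop : ∀ p q → p - q * 0ℚ ≡ p
    drop = solve-∀ ring
    distrib : ∀ p q r → (p - q) * r ≡ p * r - q * r
    distrib = solve-∀ ring
    recentre : ∀ g → ⟨ (λ x → f x - f v) , g ⟩ ≡ ⟨ f , g ⟩ - f v * sum g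
    recentre g = trans (sum-cong-≗ (λ x → distrib (f x) (f v) (g x)))
      (trans (∑-sub (λ x → f x * g x) (λ x → f v * g x)) (cong (λ e → ⟨ f , g ⟩ - e) (∑-scale (f v) g)))
    centre : ∀ p r → (p - p) * r ≡ 0ℚ
    centre = solve-∀ ring
    agree : ∀ x → (f x - f v) * L (H v) x ≡ (f x - f v) * deg x
    agree x with x Fin.≟ v
    ... | yes refl = trans (centre (f v) (L (H v) v)) (sym (centre (f v) (deg v)))
    ... | no  x≢v  = cong ((f x - f v) *_) (H-off v x≢v)

  -- Symmetry of the Laplacian: `⟨ H u , L (H v) ⟩` equals `⟨ H v , L (H u) ⟩`, and `⟨-,LH⟩`
  -- evaluates both.
  H-reversal : ∀ u v → volume * (H v u - H u v) ≡ ⟨ H v , deg ⟩ - ⟨ H u , deg ⟩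
  H-reversal u v = rearrange volume ⟨ H u , deg ⟩ ⟨ H v , deg ⟩ (H u v) (H v u)
    (trans (sym (⟨-,LH⟩ (H u) v)) (trans symmetric-form (⟨-,LH⟩ (H v) u)))
    where
    symmetric-form : ⟨ H u , L (H v) ⟩ ≡ ⟨ H v , L (H u) ⟩
    symmetric-form = double-injective (trans (green (H u) (H v))
      (trans (energy-comm (H u) (H v)) (sym (green (H v) (H u)))))
    identity₁ : ∀ w s t p q → w * (q - p) ≡ (s - w * p) - (t - w * q) + t - s
    identity₁ = solve-∀ ring
    identity₂ : ∀ w s t q → (t - w * q) - (t - w * q) + t - s ≡ t - s
    identity₂ = solve-∀ ring
    rearrange : ∀ w s t p q → s - w * p ≡ t - w * q → w * (q - p) ≡ t - s
    rearrange w s t p q e = trans (identity₁ w s t p q)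
      (trans (cong (λ z → z - (t - w * q) + t - s) e) (identity₂ w s t q))

  commute : Fin n → Fin n → ℚ
  commute u v = H v u + H u v

  -- Expand 0 ≤ energy (g - t f) for g = H v - H u, which solves L g = volume (1_u - 1_v).
  dirichlet : ∀ u v f t →
    (t + t) * (volume * (f u - f v) + volume * (f u - f v)) ≤
    (volume * commute u v + volume * commute u v) + t * t * energy f f
  dirichlet u v f t = ≤-by (energy g-tf g-tf) (0≤energy g-tf) (begin
    W + t * t * energy f f                                       ≡⟨ cong (_+ t * t * energy f f) (sym energy-gg) ⟩
    energy g g + t * t * energy f f                              ≡⟨ identity (energy g g) (energy f g) (t * t * energy f f) (t + t) ⟩
    (t + t) * energy f g + (energy g g + (- (t + t)) * energy f g + t * t * energy f f)
                                                                 ≡⟨ cong₂ _+_ (cong ((t + t) *_) (energy-fg f)) (sym expand) ⟩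
    (t + t) * (volume * (f u - f v) + volume * (f u - f v)) + energy g-tf g-tf ∎)
    where
    open ≡-Reasoning
    g g-tf : Fin n → ℚ
    g x = H v x - H u x
    g-tf x = g x - t * f x
    W = volume * commute u v + volume * commute u v
    identity : ∀ p q r s → p + r ≡ s * q + (p + (- s) * q + r)
    identity = solve-∀ ring
    termwise : ∀ c p q r s t → c * (((p - t * r) - (q - t * s)) * ((p - t * r) - (q - t * s))) ≡
      (c * ((p - q) * (p - q)) + (- (t + t)) * (c * ((r - s) * (p - q)))) + t * t * (c * ((r - s) * (r - s)))
    termwise = solve-∀ ring
    e : (Fin n → ℚ) → (Fin n → ℚ) → Fin n → Fin n → ℚ
    e p q x y = a x y * ((p x - p y) * (q x - q y))
    expand : energy g-tf g-tf ≡ energy g g + (- (t + t)) * energy f g + t * t * energy f f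
    expand = trans (∑∑-cong (λ x y → termwise (a x y) (g x) (g y) (f x) (f y) t))
      (trans (∑∑-+ (λ x y → e g g x y + (- (t + t)) * e f g x y) (λ x y → t * t * e f f x y))
      (cong₂ _+_ (trans (∑∑-+ (e g g) (λ x y → (- (t + t)) * e f g x y)) (cong (energy g g +_) (∑∑-scale (- (t + t)) (e f g))))
                 (∑∑-scale (t * t) (e f f))))
    combine : ∀ s w p q → (s - w * p) - (s - w * q) ≡ w * (q - p)
    combine = solve-∀ ring
    ⟨f,Lg⟩ : ∀ f → ⟨ f , L g ⟩ ≡ volume * (f u - f v)
    ⟨f,Lg⟩ f = trans (sum-cong-≗ (λ x → trans (cong (f x *_) (L-sub (H v) (H u) x)) (split (f x) (L (H v) x) (L (H u) x))))
      (trans (∑-sub (λ x → f x * L (H v) x) (λ x → f x * L (H u) x))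
      (trans (cong₂ _-_ (⟨-,LH⟩ f v) (⟨-,LH⟩ f u)) (combine ⟨ f , deg ⟩ volume (f v) (f u))))
      where
      split : ∀ p q r → p * (q - r) ≡ p * q - p * r
      split = solve-∀ ring
    energy-fg : ∀ f → energy f g ≡ volume * (f u - f v) + volume * (f u - f v)
    energy-fg f = trans (sym (green f g)) (cong₂ _+_ (⟨f,Lg⟩ f) (⟨f,Lg⟩ f))
    signs : ∀ p q → (p - 0ℚ) - (0ℚ - q) ≡ p + q
    signs = solve-∀ ring
    g-difference : g u - g v ≡ commute u v
    g-difference = trans (cong₂ (λ p q → (H v u - p) - (q - H u v)) (H-target u) (H-target v)) (signs (H v u) (H u v))
    energy-gg : energy g g ≡ W
    energy-gg = trans (energy-fg g) (cong (λ z → volume * z + volume * z) g-difference)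

  energy-δ : ∀ u → energy (δ u) (δ u) ≤ deg u + deg u
  energy-δ u = subst (_≤ deg u + deg u) (green (δ u) (δ u)) (+-mono-≤ half half)
    where
    half : ⟨ δ u , L (δ u) ⟩ ≤ deg u
    half = ≤-trans (≤-reflexive (∑-δ u (L (δ u)))) (∑-mono-≤ λ y →
      ≤-trans (*-monoˡ-≤ (0≤a u y) (bound (δ u u) (δ u y) (indicator≤1 (does (u Fin.≟ u))) (0≤indicator (does (u Fin.≟ y)))))
              (≤-reflexive (ℚ.*-identityʳ (a u y))))
      where
      identity : ∀ p q → 1ℚ ≡ (p - q) + ((1ℚ - p) + q)
      identity = solve-∀ ring
      bound : ∀ p q → p ≤ 1ℚ → 0ℚ ≤ q → p - q ≤ 1ℚ
      bound p q p≤1 0≤q = ≤-by ((1ℚ - p) + q) (0≤+ (≤⇒0≤- p≤1) 0≤q) (identity p q)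

  energy-lipschitz : ∀ f → (∀ {x y} → Adj x y → (f x - f y) * (f x - f y) ≤ 1ℚ) → energy f f ≤ volume
  energy-lipschitz f lip = ∑-mono-≤ λ x → ∑-mono-≤ (term x)
    where
    term : ∀ x y → a x y * ((f x - f y) * (f x - f y)) ≤ a x y
    term x y with adj? x y
    ... | yes xy = ≤-trans (≤-reflexive (ℚ.*-identityˡ _)) (lip xy)
    ... | no _   = ≤-reflexive (ℚ.*-zeroˡ ((f x - f y) * (f x - f y)))

-- Distances

minimal-witness : ∀ {P : ℕ → Set} → U.Decidable P → ∀ m → P m → ∃[ k ] (P k × (∀ {j} → P j → k ℕ.≤ j))
minimal-witness P? m Pm with P? 0
... | yes P0 = 0 , P0 , λ _ → ℕ.z≤n
minimal-witness         P? zero    Pm | no ¬P0 = contradiction Pm ¬P0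
minimal-witness {P = P} P? (suc m) Pm | no ¬P0 with minimal-witness (P? ∘ suc) m Pm
... | k , Pk , least = suc k , Pk , minimal
  where
  minimal : ∀ {j} → P j → suc k ℕ.≤ j
  minimal {zero}  Pj = contradiction Pj ¬P0
  minimal {suc j} Pj = ℕ.s≤s (least Pj)

module Distance {n : ℕ} (G : Graph n) where
  open Graph G

  -- Walks of length at most `k`, in a decidable form, so that the distance is found by search below
  -- the length of any given walk.
  Within : ℕ → Fin n → Fin n → Set
  Within zero    v x = x ≡ v
  Within (suc k) v x = Within k v x ⊎ ∃[ y ] (Adj x y × Within k v y)

  within? : ∀ k v → U.Decidable (Within k v)
  within? zero    v x = x Fin.≟ v
  within? (suc k) v x = within? k v x ⊎-dec any? λ y → adj? x y ×-dec within? k v y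

  walk⇒within : ∀ {x v} → Star Adj x v → ∃[ k ] Within k v x
  walk⇒within ε        = 0 , refl
  walk⇒within (xy ◅ p) = let k , w = walk⇒within p in suc k , inj₂ (_ , xy , w)

  abstract

    shortest : ∀ v x → ∃[ k ] (Within k v x × (∀ {j} → Within j v x → k ℕ.≤ j))
    shortest v x = let k , w = walk⇒within (connected x v) in minimal-witness (λ k → within? k v x) k w

  dist : Fin n → Fin n → ℕ
  dist v x = proj₁ (shortest v x)

  within-dist : ∀ v x → Within (dist v x) v x
  within-dist v x = proj₁ (proj₂ (shortest v x))

  dist-minimal : ∀ v x {k} → Within k v x → dist v x ℕ.≤ k
  dist-minimal v x = proj₂ (proj₂ (shortest v x))

  dist-self : ∀ v → dist v v ≡ 0
  dist-self v = ℕ.n≤0⇒n≡0 (dist-minimal v v {0} refl)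

  dist≡0⇒≡ : ∀ v x → dist v x ≡ 0 → x ≡ v
  dist≡0⇒≡ v x d≡0 = subst (λ k → Within k v x) d≡0 (within-dist v x)

  dist-adj : ∀ v {x y} → Adj x y → dist v x ℕ.≤ suc (dist v y)
  dist-adj v {x} {y} xy = dist-minimal v x {suc (dist v y)} (inj₂ (y , xy , within-dist v y))

  dist-closer : ∀ v x {k} → dist v x ≡ suc k → ∃[ y ] (Adj x y × dist v y ℕ.≤ k)
  dist-closer v x {k} d≡ with subst (λ j → Within j v x) d≡ (within-dist v x)
  ... | inj₁ w            = contradiction (subst (ℕ._≤ k) d≡ (dist-minimal v x w)) (ℕ.<-irrefl refl)
  ... | inj₂ (y , xy , w) = y , xy , dist-minimal v y w

  -- The difference 1 - (p - q)² factors, and the two factors are nonnegative by `dist-adj` for the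
  -- two directions of the edge.
  dist-lipschitz : ∀ v {x y} → Adj x y → (ℕ→ℚ (dist v x) - ℕ→ℚ (dist v y)) * (ℕ→ℚ (dist v x) - ℕ→ℚ (dist v y)) ≤ 1ℚ
  dist-lipschitz v {x} {y} xy = ≤-by ((1ℚ + q - p) * (1ℚ + p - q))
    (0≤* (≤⇒0≤- (step (dist-adj v xy))) (≤⇒0≤- (step (dist-adj v (symmetric xy))))) (identity p q)
    where
    p = ℕ→ℚ (dist v x)
    q = ℕ→ℚ (dist v y)
    step : ∀ {i j} → i ℕ.≤ suc j → ℕ→ℚ i ≤ 1ℚ + ℕ→ℚ j
    step {i} {j} i≤1+j = subst (ℕ→ℚ i ≤_) (ℕ→ℚ-suc j) (ℕ→ℚ-mono-≤ i≤1+j)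
    identity : ∀ p q → 1ℚ ≡ (p - q) * (p - q) + (1ℚ + q - p) * (1ℚ + p - q)
    identity = solve-∀ ring

least-mono : ∀ {N} {P Q : Fin N → Set} (P? : U.Decidable P) (Q? : U.Decidable Q) →
             (∀ t → P t → Q t) → least Q? ℕ.≤ least P?
least-mono {zero}  P? Q? P⇒Q = ℕ.z≤n
least-mono {suc N} P? Q? P⇒Q with P? zero | Q? zero
... | _      | yes _  = ℕ.z≤n
... | yes P0 | no ¬Q0 = contradiction (P⇒Q zero P0) ¬Q0
... | no _   | no _   = ℕ.s≤s (least-mono (P? ∘ suc) (Q? ∘ suc) (P⇒Q ∘ suc))

least-minimal : ∀ {N} {P : Fin N → Set} (P? : U.Decidable P) t → P t → least P? ℕ.≤ toℕ t
least-minimal {suc N} P? t Pt with P? zero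
... | yes _ = ℕ.z≤n
least-minimal {suc N} P? zero    Pt | no ¬P0 = contradiction Pt ¬P0
least-minimal {suc N} P? (suc t) Pt | no _   = ℕ.s≤s (least-minimal (P? ∘ suc) t Pt)

least-satisfies : ∀ {N} {P : Fin N → Set} (P? : U.Decidable P) → least P? ℕ.< N → ∃[ t ] (toℕ t ≡ least P? × P t)
least-satisfies {suc N} P? lt with P? zero
... | yes P0 = zero , refl , P0
... | no _   = let t , eq , Pt = least-satisfies (P? ∘ suc) (ℕ.s≤s⁻¹ lt) in suc t , cong suc eq , Pt

-- Expectations

sumℚ-++ : ∀ xs ys → sumℚ (xs ++ ys) ≡ sumℚ xs + sumℚ ys
sumℚ-++ []       ys = sym (ℚ.+-identityˡ (sumℚ ys))
sumℚ-++ (x ∷ xs) ys = trans (cong (x +_) (sumℚ-++ xs ys)) (sym (ℚ.+-assoc x (sumℚ xs) (sumℚ ys)))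

module _ {A : Set} where

  expectation-cong : ∀ (d : Dist A) {F G : A → ℚ} → (∀ x → F x ≡ G x) → expectation d F ≡ expectation d G
  expectation-cong []            F≗G = refl
  expectation-cong ((x , p) ∷ d) F≗G = cong₂ _+_ (cong (p *_) (F≗G x)) (expectation-cong d F≗G)

  expectation-+ : ∀ (d : Dist A) (F G : A → ℚ) → expectation d (λ x → F x + G x) ≡ expectation d F + expectation d G
  expectation-+ []            F G = refl
  expectation-+ ((x , p) ∷ d) F G = trans (cong (p * (F x + G x) +_) (expectation-+ d F G))
    (identity p (F x) (G x) (expectation d F) (expectation d G))
    where
    identity : ∀ p f g r s → p * (f + g) + (r + s) ≡ (p * f + r) + (p * g + s)
    identity = solve-∀ ring

  expectation-scale : ∀ (d : Dist A) c (F : A → ℚ) → expectation d (λ x → c * F x) ≡ c * expectation d F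
  expectation-scale []            c F = sym (ℚ.*-zeroʳ c)
  expectation-scale ((x , p) ∷ d) c F = trans (cong (p * (c * F x) +_) (expectation-scale d c F)) (identity p c (F x) (expectation d F))
    where
    identity : ∀ p c f r → p * (c * f) + c * r ≡ c * (p * f + r)
    identity = solve-∀ ring

  expectation-∑ : ∀ {n} (d : Dist A) (F : Fin n → A → ℚ) → expectation d (λ x → sum (λ i → F i x)) ≡ sum (λ i → expectation d (F i))
  expectation-∑ {zero}  d F = trans (expectation-scale d 0ℚ (λ _ → 0ℚ)) (ℚ.*-zeroˡ (expectation d (λ _ → 0ℚ)))
  expectation-∑ {suc n} d F = trans (expectation-+ d (F zero) (λ x → sum (λ i → F (suc i) x)))
                                    (cong (expectation d (F zero) +_) (expectation-∑ d (F ∘ suc)))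

  expectation-return : ∀ (x : A) F → expectation (return x) F ≡ F x
  expectation-return x F = trans (ℚ.+-identityʳ (1ℚ * F x)) (ℚ.*-identityˡ (F x))

  -- Positivity and normalization are required of the expectation functional and not of the listed
  -- weights: in this form they pass through `_>>=_` by the tower rule.
  record IsProbability (d : Dist A) : Set where
    field
      nonneg : ∀ {F} → (∀ x → 0ℚ ≤ F x) → 0ℚ ≤ expectation d F
      total  : expectation d (λ _ → 1ℚ) ≡ 1ℚ

    expectation-const : ∀ c → expectation d (λ _ → c) ≡ c
    expectation-const c = trans (expectation-cong d (λ _ → sym (ℚ.*-identityʳ c)))
      (trans (expectation-scale d c (λ _ → 1ℚ)) (trans (cong (c *_) total) (ℚ.*-identityʳ c)))

    expectation-shift : ∀ c F → expectation d (λ x → c + F x) ≡ c + expectation d F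
    expectation-shift c F = trans (expectation-+ d (λ _ → c) F) (cong (_+ expectation d F) (expectation-const c))

    expectation-mono : ∀ {F G : A → ℚ} → (∀ x → F x ≤ G x) → expectation d F ≤ expectation d G
    expectation-mono {F} {G} F≤G = ≤-by (expectation d (λ x → G x - F x)) (nonneg (λ x → ≤⇒0≤- (F≤G x)))
      (trans (expectation-cong d (λ x → identity (F x) (G x))) (expectation-+ d F (λ x → G x - F x)))
      where
      identity : ∀ p q → q ≡ p + (q - p)
      identity = solve-∀ ring

open IsProbability

return-isProbability : ∀ {A : Set} (x : A) → IsProbability (return x)
return-isProbability x .nonneg {F} 0≤F = subst (0ℚ ≤_) (sym (expectation-return x F)) (0≤F x)
return-isProbability x .total          = refl

expectation->>= : ∀ {A B : Set} (d : Dist A) (f : A → Dist B) (F : B → ℚ) →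
                  expectation (d >>= f) F ≡ expectation d (λ x → expectation (f x) F)
expectation->>= []            f F = refl
expectation->>= {A} {B} ((x , p) ∷ d) f F = begin
  sumℚ (List.map weigh (List.map rescale (f x) ++ (d >>= f)))       ≡⟨ cong sumℚ (map-++ weigh (List.map rescale (f x)) (d >>= f)) ⟩
  sumℚ (List.map weigh (List.map rescale (f x)) ++ List.map weigh (d >>= f)) ≡⟨ sumℚ-++ (List.map weigh (List.map rescale (f x))) _ ⟩
  expectation (List.map rescale (f x)) F + expectation (d >>= f) F  ≡⟨ cong₂ _+_ (rescaled (f x)) (expectation->>= d f F) ⟩
  p * expectation (f x) F + expectation d (λ x → expectation (f x) F) ∎
  where
  open ≡-Reasoning
  weigh : B × ℚ → ℚ
  weigh (y , r) = r * F y
  rescale : B × ℚ → B × ℚ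
  rescale (y , r) = y , p * r
  identity : ∀ p r f e → p * r * f + p * e ≡ p * (r * f + e)
  identity = solve-∀ ring
  rescaled : ∀ e → expectation (List.map rescale e) F ≡ p * expectation e F
  rescaled []            = sym (ℚ.*-zeroʳ p)
  rescaled ((y , r) ∷ e) = trans (cong (p * r * F y +_) (rescaled e)) (identity p r (F y) (expectation e F))

>>=-isProbability : ∀ {A B : Set} {d : Dist A} {f : A → Dist B} →
                    IsProbability d → (∀ x → IsProbability (f x)) → IsProbability (d >>= f)
>>=-isProbability {d = d} {f} D P .nonneg {F} 0≤F =
  subst (0ℚ ≤_) (sym (expectation->>= d f F)) (nonneg D λ x → nonneg (P x) 0≤F)
>>=-isProbability {d = d} {f} D P .total =
  trans (expectation->>= d f (λ _ → 1ℚ)) (trans (expectation-cong d (λ x → total (P x))) (total D))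

expectation-constantWeight : ∀ {A : Set} c (F : A → ℚ) xs → expectation (List.map (λ x → x , c) xs) F ≡ c * sumℚ (List.map F xs)
expectation-constantWeight c F []       = sym (ℚ.*-zeroʳ c)
expectation-constantWeight c F (x ∷ xs) = trans (cong (c * F x +_) (expectation-constantWeight c F xs)) (sym (ℚ.*-distribˡ-+ c (F x) (sumℚ (List.map F xs))))

expectation-uniform : ∀ {A : Set} (F : A → ℚ) x xs →
                      expectation (uniform (x ∷ xs)) F ≡ 1/suc (length xs) * sumℚ (List.map F (x ∷ xs))
expectation-uniform F x xs = expectation-constantWeight (1/suc (length xs)) F (x ∷ xs)

sumℚ-nonneg : ∀ {A : Set} {F : A → ℚ} → (∀ x → 0ℚ ≤ F x) → ∀ xs → 0ℚ ≤ sumℚ (List.map F xs)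
sumℚ-nonneg 0≤F []       = ≤-refl
sumℚ-nonneg 0≤F (x ∷ xs) = 0≤+ (0≤F x) (sumℚ-nonneg 0≤F xs)

uniform-isProbability : ∀ {A : Set} (x : A) xs → IsProbability (uniform (x ∷ xs))
uniform-isProbability x xs .nonneg {F} 0≤F = subst (0ℚ ≤_) (sym (expectation-uniform F x xs))
  (0≤* (0≤1/suc (length xs)) (sumℚ-nonneg 0≤F (x ∷ xs)))
uniform-isProbability x xs .total = trans (expectation-uniform (λ _ → 1ℚ) x xs)
  (trans (cong (1/suc (length xs) *_) (trans (sumℚ-const 1ℚ (x ∷ xs)) (ℚ.*-identityʳ (ℕ→ℚ (suc (length xs))))))
         (1/suc-inverse (length xs)))

module _ {S : Set} (step : S → Dist S) where

  expectation-trajectory : ∀ N x (F : Vec S (suc N) → ℚ) →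
    expectation (trajectory step (suc N) x) F ≡ expectation (step x) (λ y → expectation (trajectory step N y) (λ ys → F (x ∷ ys)))
  expectation-trajectory N x F = trans (expectation->>= (step x) _ F) (expectation-cong (step x) λ y →
    trans (expectation->>= (trajectory step N y) _ F) (expectation-cong (trajectory step N y) λ ys → expectation-return (x ∷ ys) F))

  trajectory-isProbability : (∀ x → IsProbability (step x)) → ∀ N x → IsProbability (trajectory step N x)
  trajectory-isProbability P zero    x = return-isProbability []
  trajectory-isProbability P (suc N) x = >>=-isProbability (P x) λ y →
    >>=-isProbability (trajectory-isProbability P N y) λ ys → return-isProbability (x ∷ ys)

-- 1/2 + 1/3 + ... + 1/k, which is 0 (not -1) for k = 0.
harmonic-1 : ℕ → ℚ
harmonic-1 zero          = 0ℚ
harmonic-1 (suc zero)    = 0ℚ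
harmonic-1 (suc (suc k)) = harmonic-1 (suc k) + 1/suc (suc k)

harmonic-1≤ : ∀ k → harmonic-1 k ≤ ℕ→ℚ k
harmonic-1≤ zero          = ≤-refl
harmonic-1≤ (suc zero)    = 0≤1
harmonic-1≤ (suc (suc k)) = ≤-trans (+-mono-≤ (harmonic-1≤ (suc k)) (1/suc-antimono {0} {suc k} ℕ.z≤n))
  (≤-reflexive (trans (ℚ.+-comm (ℕ→ℚ (suc k)) 1ℚ) (sym (ℕ→ℚ-suc (suc k)))))

-- The value 0 for no items makes `Φ` vanish once every target has been visited.
mean : ℕ → ℚ → ℚ
mean zero    s = 0ℚ
mean (suc k) s = 1/suc k * s

sumℚ-mono-≤ : ∀ {A : Set} {f g : A → ℚ} xs → (∀ {x} → x ∈ xs → f x ≤ g x) → sumℚ (List.map f xs) ≤ sumℚ (List.map g xs)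
sumℚ-mono-≤ []       f≤g = ≤-refl
sumℚ-mono-≤ (x ∷ xs) f≤g = +-mono-≤ (f≤g (here refl)) (sumℚ-mono-≤ xs (f≤g ∘ there))

-- Lists of targets and the time to visit them

module _ {n : ℕ} where

  infixl 6 _∖_

  _∖_ : List (Fin n) → Fin n → List (Fin n)
  xs ∖ y = filter (λ v → ¬? (v Fin.≟ y)) xs

  ∖-∉ : ∀ {y} xs → y ∉ xs → xs ∖ y ≡ xs
  ∖-∉ {y} xs y∉xs = filter-all (λ v → ¬? (v Fin.≟ y)) (All.tabulate λ v∈xs v≡y → y∉xs (subst (_∈ xs) v≡y v∈xs))

  ∈-∖⁻ : ∀ {y v} xs → v ∈ xs ∖ y → v ∈ xs × v ≢ y
  ∈-∖⁻ {y} xs = ∈-filter⁻ (λ v → ¬? (v Fin.≟ y)) {xs = xs}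

  ∖-unique : ∀ {xs} y → Unique xs → Unique (xs ∖ y)
  ∖-unique y = Unique.filter⁺ (λ v → ¬? (v Fin.≟ y))

  ∖-cons-same : ∀ y xs → (y ∷ xs) ∖ y ≡ xs ∖ y
  ∖-cons-same y xs = filter-reject (λ v → ¬? (v Fin.≟ y)) (λ y≢y → y≢y refl)

  ∖-cons-distinct : ∀ {x y} xs → x ≢ y → (x ∷ xs) ∖ y ≡ x ∷ xs ∖ y
  ∖-cons-distinct {y = y} xs x≢y = filter-accept (λ v → ¬? (v Fin.≟ y)) x≢y

  head-∉ : ∀ {x : Fin n} {xs} → All (x ≢_) xs → x ∉ xs
  head-∉ x≢xs x∈xs = All.lookup x≢xs x∈xs refl

  length-∖ : ∀ {xs y} → Unique xs → y ∈ xs → length xs ≡ suc (length (xs ∖ y))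
  length-∖ {x ∷ xs} (x≢xs ∷ _) (here refl) =
    cong suc (cong length (sym (trans (∖-cons-same x xs) (∖-∉ xs (head-∉ x≢xs)))))
  length-∖ {x ∷ xs} {y} (x≢xs ∷ u) (there y∈xs) =
    trans (cong suc (length-∖ u y∈xs)) (cong suc (cong length (sym (∖-cons-distinct xs (All.lookup x≢xs y∈xs)))))

  sumℚ-∖ : ∀ (f : Fin n → ℚ) {xs y} → Unique xs → y ∈ xs → sumℚ (List.map f xs) ≡ f y + sumℚ (List.map f (xs ∖ y))
  sumℚ-∖ f {x ∷ xs} (x≢xs ∷ _) (here refl) =
    cong (λ ys → f x + sumℚ (List.map f ys)) (sym (trans (∖-cons-same x xs) (∖-∉ xs (head-∉ x≢xs))))
  sumℚ-∖ f {x ∷ xs} {y} (x≢xs ∷ u) (there y∈xs) = begin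
    f x + sumℚ (List.map f xs)                    ≡⟨ cong (f x +_) (sumℚ-∖ f u y∈xs) ⟩
    f x + (f y + sumℚ (List.map f (xs ∖ y)))      ≡⟨ exchange (f x) (f y) (sumℚ (List.map f (xs ∖ y))) ⟩
    f y + (f x + sumℚ (List.map f (xs ∖ y)))      ≡⟨ cong (λ ys → f y + sumℚ (List.map f ys)) (sym (∖-cons-distinct xs (All.lookup x≢xs y∈xs))) ⟩
    f y + sumℚ (List.map f ((x ∷ xs) ∖ y))        ∎
    where
    open ≡-Reasoning
    exchange : ∀ p q r → p + (q + r) ≡ q + (p + r)
    exchange = solve-∀ ring

  VisitedBy : ∀ {N} → Vec (Fin n) N → Fin N → Fin n → Set
  VisitedBy xs t v = ∃[ i ] (i Fin.≤ t × lookup xs i ≡ v)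

  visitedBy? : ∀ {N} (xs : Vec (Fin n) N) t → U.Decidable (VisitedBy xs t)
  visitedBy? xs t v = any? λ i → i Fin.≤? t ×-dec lookup xs i Fin.≟ v

  allVisited? : ∀ T {N} (xs : Vec (Fin n) N) → U.Decidable (λ t → All (VisitedBy xs t) T)
  allVisited? T xs t = All.all? (visitedBy? xs t) T

  allVisited-tail : ∀ T {N} x (xs : Vec (Fin n) N) t → All (VisitedBy (x ∷ xs) (suc t)) T → All (VisitedBy xs t) (T ∖ x)
  allVisited-tail T x xs t visited = All.tabulate later
    where
    later : ∀ {v} → v ∈ T ∖ x → VisitedBy xs t v
    later v∈ with ∈-∖⁻ T v∈
    ... | v∈T , v≢x with All.lookup visited v∈T
    ...   | zero  , _          , x≡v  = contradiction (sym x≡v) v≢x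
    ...   | suc i , ℕ.s≤s i≤t , xsᵢ≡v = i , i≤t , xsᵢ≡v

  -- At time 0 only `x` is visited, so a target other than `x` forces a first step; afterwards the
  -- targets other than `x` must still be visited.
  least-allVisited : ∀ T {N} x (xs : Vec (Fin n) N) {v} → v ∈ T ∖ x →
                     suc (least (allVisited? (T ∖ x) xs)) ℕ.≤ least (allVisited? T (x ∷ xs))
  least-allVisited T x xs v∈ with allVisited? T (x ∷ xs) zero
  ... | no _ = ℕ.s≤s (least-mono (λ t → allVisited? T (x ∷ xs) (suc t)) (allVisited? (T ∖ x) xs) (allVisited-tail T x xs))
  ... | yes visited with ∈-∖⁻ T v∈
  ...   | v∈T , v≢x with All.lookup visited v∈T
  ...     | zero , _ , x≡v = contradiction (sym x≡v) v≢x

-- Matthews' argument as a submartingale: g v is the hitting time of v shifted by b v, so that the harmonic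
-- number in Φ makes up for the change of the average when a target is removed.

module Matthews {n : ℕ} (step : Fin n → Dist (Fin n)) (step-isProbability : ∀ x → IsProbability (step x))
  (A : List (Fin n)) (g : Fin n → Fin n → ℚ) (b : Fin n → ℚ) (K : ℚ) (0≤K : 0ℚ ≤ K)
  (g-step : ∀ {v x} → x ≢ v → g v x ≤ 1ℚ + expectation (step x) (g v))
  (g-far : ∀ {u v} → u ∈ A → v ∈ A → u ≢ v → K + b u ≤ g v u)
  (g-self : ∀ v → g v v ≡ b v)
  (b≤0 : ∀ {v} → v ∈ A → b v ≤ 0ℚ)
  where

  S : List (Fin n) → Fin n → ℚ
  S T x = sumℚ (List.map (λ v → g v x) T)

  -- An estimate from below for the time still needed at `x` when `T` is unvisited. Averaging over
  -- the targets in `T` stands in for the random order of targets in the classical proof.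
  Φ : List (Fin n) → Fin n → ℚ
  Φ T x = mean (length T) (S T x) + K * harmonic-1 (length T)

  mean-lower : ∀ k {s c} → ℕ→ℚ (suc k) * c ≤ s → c ≤ 1/suc k * s
  mean-lower k {s} {c} kc≤s = ≤-trans (≤-reflexive (trans (sym (ℚ.*-identityˡ c))
    (trans (cong (_* c) (sym (1/suc-inverse k))) (ℚ.*-assoc (1/suc k) (ℕ→ℚ (suc k)) c)))) (*-monoˡ-≤ (0≤1/suc k) kc≤s)

  mean-upper : ∀ k {s c} → s ≤ ℕ→ℚ (suc k) * c → 1/suc k * s ≤ c
  mean-upper k {s} {c} s≤kc = ≤-trans (*-monoˡ-≤ (0≤1/suc k) s≤kc) (≤-reflexive
    (trans (sym (ℚ.*-assoc (1/suc k) (ℕ→ℚ (suc k)) c)) (trans (cong (_* c) (1/suc-inverse k)) (ℚ.*-identityˡ c))))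

  -- Let m be the mean over the `suc k` targets that stay and `c` the value at the removed one. The
  -- removal raises the mean by (m - c)/(k + 2), which is at least K/(k + 2) by hypothesis: exactly
  -- the harmonic term that is lost.
  potential-drop : ∀ k {s c} → ℕ→ℚ (suc k) * (K + c) ≤ s →
    1/suc (suc k) * (c + s) + K * (harmonic-1 (suc k) + 1/suc (suc k)) ≤ 1/suc k * s + K * harmonic-1 (suc k)
  potential-drop k {s} {c} h = ≤-by (q * (p * s - (K + c))) (0≤* (0≤1/suc (suc k)) (≤⇒0≤- (mean-lower k h)))
    (trans (cong (_+ K * e) (trans p*s (expand p q s k+1 pk≡1))) (identity p q s c K e))
    where
    p = 1/suc k
    q = 1/suc (suc k)
    e = harmonic-1 (suc k)
    k+1 = ℕ→ℚ (suc k)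
    pk≡1 : p * k+1 ≡ 1ℚ
    pk≡1 = 1/suc-inverse k
    qk≡1 : q * (1ℚ + k+1) ≡ 1ℚ
    qk≡1 = trans (cong (q *_) (sym (ℕ→ℚ-suc (suc k)))) (1/suc-inverse (suc k))
    p*s : p * s ≡ (q * (1ℚ + k+1)) * (p * s)
    p*s = trans (sym (ℚ.*-identityˡ (p * s))) (cong (_* (p * s)) (sym qk≡1))
    expand : ∀ p q s m → p * m ≡ 1ℚ → (q * (1ℚ + m)) * (p * s) ≡ q * (p * s + s)
    expand p q s m pm≡1 = trans (assoc p q s m) (trans (cong (λ z → q * (p * s + z * s)) pm≡1) (cong (λ z → q * (p * s + z)) (ℚ.*-identityˡ s)))
      where
      assoc : ∀ p q s m → (q * (1ℚ + m)) * (p * s) ≡ q * (p * s + p * m * s)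
      assoc = solve-∀ ring
    identity : ∀ p q s c K e → q * (p * s + s) + K * e ≡ (q * (c + s) + K * (e + q)) + q * (p * s - (K + c))
    identity = solve-∀ ring

  S-far : ∀ {y} T → y ∈ A → (∀ {v} → v ∈ T → v ∈ A × v ≢ y) → ℕ→ℚ (length T) * (K + b y) ≤ S T y
  S-far {y} T y∈A far = ≤-trans (≤-reflexive (sym (sumℚ-const (K + b y) T)))
    (sumℚ-mono-≤ T λ v∈T → let v∈A , v≢y = far v∈T in g-far y∈A v∈A (≢-sym v≢y))

  -- With other targets left this is `potential-drop`. If `y` was the last one, the potential goes
  -- from `b y` to 0, which is where `b≤0` enters.
  Φ-drop : ∀ y T′ → y ∈ A → (∀ {v} → v ∈ T′ → v ∈ A × v ≢ y) →
           mean (suc (length T′)) (b y + S T′ y) + K * harmonic-1 (suc (length T′)) ≤ Φ T′ y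
  Φ-drop y []         y∈A far = ≤-trans (≤-reflexive (trans (cong (_+ K * 0ℚ) (ℚ.*-identityˡ (b y + 0ℚ))) (zeros (b y) K)))
    (≤-trans (b≤0 y∈A) (≤-reflexive (sym (zeros 0ℚ K))))
    where
    zeros : ∀ p q → (p + 0ℚ) + q * 0ℚ ≡ p
    zeros = solve-∀ ring
  Φ-drop y T′@(_ ∷ vs) y∈A far = potential-drop (length vs) (S-far T′ y∈A far)

  Φ-remove : ∀ {T} y → Unique T → (∀ {v} → v ∈ T → v ∈ A) → Φ T y ≤ Φ (T ∖ y) y
  Φ-remove {T} y unique T⊆A with member? Fin._≟_ y T
  ... | no  y∉T = ≤-reflexive (cong (λ T → Φ T y) (sym (∖-∉ T y∉T)))
  ... | yes y∈T = ≤-trans (≤-reflexive (trans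
        (cong (λ s → mean (length T) s + K * harmonic-1 (length T)) (trans (sumℚ-∖ (λ v → g v y) unique y∈T) (cong (_+ S (T ∖ y) y) (g-self y))))
        (cong (λ k → mean k (b y + S (T ∖ y) y) + K * harmonic-1 k) (length-∖ unique y∈T))))
      (Φ-drop y (T ∖ y) (T⊆A y∈T) λ v∈ → let v∈T , v≢y = ∈-∖⁻ T v∈ in T⊆A v∈T , v≢y)

  S-step : ∀ T x → (∀ {v} → v ∈ T → v ≢ x) → S T x ≤ ℕ→ℚ (length T) + expectation (step x) (S T)
  S-step []       x x∉T = ≤-reflexive (sym (cong (0ℚ +_) (expectation-const (step-isProbability x) 0ℚ)))
  S-step (v ∷ T) x x∉T = ≤-trans (+-mono-≤ (g-step (≢-sym (x∉T (here refl)))) (S-step T x (x∉T ∘ there)))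
    (≤-reflexive (trans (identity 1ℚ (expectation (step x) (g v)) (ℕ→ℚ (length T)) (expectation (step x) (S T)))
      (cong₂ _+_ (sym (ℕ→ℚ-suc (length T))) (sym (expectation-+ (step x) (g v) (S T))))))
    where
    identity : ∀ o p q r → (o + p) + (q + r) ≡ (o + q) + (p + r)
    identity = solve-∀ ring

  -- While no target is hit, each `g v` loses at most 1 on average, hence so does the mean; the
  -- harmonic term stays constant.
  Φ-step : ∀ v T x → (∀ {u} → u ∈ v ∷ T → u ≢ x) → Φ (v ∷ T) x ≤ 1ℚ + expectation (step x) (Φ (v ∷ T))
  Φ-step v T x x∉T = ≤-trans (+-mono-≤ (≤-trans (*-monoˡ-≤ (0≤1/suc k) (S-step (v ∷ T) x x∉T)) (≤-reflexive scaled)) ≤-refl)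
    (≤-reflexive (trans (ℚ.+-assoc 1ℚ (q * ES) C) (cong (1ℚ +_) (sym linear))))
    where
    k = length T
    q = 1/suc k
    C = K * harmonic-1 (suc k)
    ES = expectation (step x) (S (v ∷ T))
    scaled : q * (ℕ→ℚ (suc k) + ES) ≡ 1ℚ + q * ES
    scaled = trans (ℚ.*-distribˡ-+ q (ℕ→ℚ (suc k)) ES) (cong (_+ q * ES) (1/suc-inverse k))
    linear : expectation (step x) (Φ (v ∷ T)) ≡ q * ES + C
    linear = trans (expectation-+ (step x) (λ y → q * S (v ∷ T) y) (λ _ → C))
      (cong₂ _+_ (expectation-scale (step x) q (S (v ∷ T))) (expectation-const (step-isProbability x) C))

  coverBy : ℕ → List (Fin n) → Fin n → ℚ
  coverBy N T x = expectation (trajectory step N x) (λ xs → ℕ→ℚ (least (allVisited? T xs)))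

  0≤coverBy : ∀ N T x → 0ℚ ≤ coverBy N T x
  0≤coverBy N T x = nonneg (trajectory-isProbability step step-isProbability N x) λ xs → 0≤ℕ→ℚ (least (allVisited? T xs))

  coverBy-step : ∀ N T x {v} → v ∈ T ∖ x → 1ℚ + expectation (step x) (coverBy N (T ∖ x)) ≤ coverBy (suc N) T x
  coverBy-step N T x v∈ = begin
    1ℚ + expectation (step x) (coverBy N (T ∖ x))             ≡⟨ sym (expectation-shift (step-isProbability x) 1ℚ (coverBy N (T ∖ x))) ⟩
    expectation (step x) (λ y → 1ℚ + coverBy N (T ∖ x) y)     ≤⟨ expectation-mono (step-isProbability x) later ⟩
    expectation (step x) (λ y → expectation (trajectory step N y) (λ ys → ℕ→ℚ (least (allVisited? T (x ∷ ys)))))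
                                                              ≡⟨ sym (expectation-trajectory step N x (λ xs → ℕ→ℚ (least (allVisited? T xs)))) ⟩
    coverBy (suc N) T x                                       ∎
    where
    open ℚ.≤-Reasoning
    later : ∀ y → 1ℚ + coverBy N (T ∖ x) y ≤ expectation (trajectory step N y) (λ ys → ℕ→ℚ (least (allVisited? T (x ∷ ys))))
    later y = ≤-trans (≤-reflexive (sym (expectation-shift P 1ℚ (λ ys → ℕ→ℚ (least (allVisited? (T ∖ x) ys))))))
      (expectation-mono P λ ys → ≤-trans (≤-reflexive (sym (ℕ→ℚ-suc (least (allVisited? (T ∖ x) ys)))))
        (ℕ→ℚ-mono-≤ {suc (least (allVisited? (T ∖ x) ys))} {least (allVisited? T (x ∷ ys))} (least-allVisited T x ys v∈)))
      where P = trajectory-isProbability step step-isProbability N y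

  -- Time counts twice on the right: one copy pays for the decrease of Φ by at most 1 per step, the other
  -- for the potential that is left at the horizon.
  module _ (M : ℕ) (ℓ : ℕ) (Φ≤M : ∀ T x → length T ℕ.≤ ℓ → Φ T x ≤ ℕ→ℚ M) where

    cover-lower : ∀ j → j ℕ.≤ M → ∀ {T} x → Unique T → (∀ {v} → v ∈ T → v ∈ A) → length T ℕ.≤ ℓ →
                  Φ (T ∖ x) x + ℕ→ℚ j ≤ (coverBy j T x + coverBy j T x) + ℕ→ℚ M
    cover-lower zero j≤M {T} x unique T⊆A T≤ℓ =
      +-mono-≤-comm (Φ≤M (T ∖ x) x (ℕ.≤-trans (length-filter _ T) T≤ℓ)) (0≤+ (0≤coverBy 0 T x) (0≤coverBy 0 T x))
      where
      swap : ∀ p q → p + q ≡ q + p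
      swap = solve-∀ ring
      +-mono-≤-comm : ∀ {p q r} → p ≤ q → 0ℚ ≤ r → p + 0ℚ ≤ r + q
      +-mono-≤-comm {p} {q} {r} p≤q 0≤r = ≤-trans (+-mono-≤ p≤q 0≤r) (≤-reflexive (swap q r))
    cover-lower (suc j) j<M {T} x unique T⊆A T≤ℓ = go (T ∖ x) refl
      where
      go : ∀ T′ → T ∖ x ≡ T′ → Φ T′ x + ℕ→ℚ (suc j) ≤ (coverBy (suc j) T x + coverBy (suc j) T x) + ℕ→ℚ M
      go [] _ = +-mono-≤ (≤-trans (≤-reflexive (zeros K)) (0≤+ (0≤coverBy (suc j) T x) (0≤coverBy (suc j) T x)))
                         (ℕ→ℚ-mono-≤ {suc j} {M} j<M)
        where
        zeros : ∀ p → 0ℚ + p * 0ℚ ≡ 0ℚ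
        zeros = solve-∀ ring
      go T′@(v ∷ T″) T′≡ = begin
        Φ T′ x + ℕ→ℚ (suc j)                                   ≡⟨ cong (Φ T′ x +_) (ℕ→ℚ-suc j) ⟩
        Φ T′ x + (1ℚ + ℕ→ℚ j)                                  ≤⟨ +-mono-≤ (Φ-step v T″ x x∉T′) ≤-refl ⟩
        (1ℚ + expectation (step x) (Φ T′)) + (1ℚ + ℕ→ℚ j)      ≡⟨ regroup 1ℚ (expectation (step x) (Φ T′)) (ℕ→ℚ j) ⟩
        (1ℚ + 1ℚ) + (ℕ→ℚ j + expectation (step x) (Φ T′))      ≡⟨ cong ((1ℚ + 1ℚ) +_) (sym (expectation-shift P (ℕ→ℚ j) (Φ T′))) ⟩
        (1ℚ + 1ℚ) + expectation (step x) (λ y → ℕ→ℚ j + Φ T′ y) ≤⟨ ℚ.+-monoʳ-≤ (1ℚ + 1ℚ) (expectation-mono P IH) ⟩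
        (1ℚ + 1ℚ) + expectation (step x) (λ y → ℕ→ℚ M + (coverBy j T′ y + coverBy j T′ y))
          ≡⟨ cong ((1ℚ + 1ℚ) +_) (trans (expectation-shift P (ℕ→ℚ M) (λ y → coverBy j T′ y + coverBy j T′ y))
               (cong (ℕ→ℚ M +_) (expectation-+ (step x) (coverBy j T′) (coverBy j T′)))) ⟩
        (1ℚ + 1ℚ) + (ℕ→ℚ M + (E + E))                          ≡⟨ regroup₂ 1ℚ (ℕ→ℚ M) E ⟩
        ((1ℚ + E) + (1ℚ + E)) + ℕ→ℚ M                          ≤⟨ +-mono-≤ (+-mono-≤ onward onward) ≤-refl ⟩
        (coverBy (suc j) T x + coverBy (suc j) T x) + ℕ→ℚ M    ∎
        where
        open ℚ.≤-Reasoning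
        P = step-isProbability x
        E = expectation (step x) (coverBy j T′)
        regroup : ∀ o e j → (o + e) + (o + j) ≡ (o + o) + (j + e)
        regroup = solve-∀ ring
        regroup₂ : ∀ o m e → (o + o) + (m + (e + e)) ≡ ((o + e) + (o + e)) + m
        regroup₂ = solve-∀ ring
        T′⊆T∖x : ∀ {u} → u ∈ T′ → u ∈ T ∖ x
        T′⊆T∖x {u} = subst (u ∈_) (sym T′≡)
        x∉T′ : ∀ {u} → u ∈ T′ → u ≢ x
        x∉T′ u∈ = proj₂ (∈-∖⁻ T (T′⊆T∖x u∈))
        T′⊆A : ∀ {u} → u ∈ T′ → u ∈ A
        T′⊆A u∈ = T⊆A (proj₁ (∈-∖⁻ T (T′⊆T∖x u∈)))
        unique′ : Unique T′
        unique′ = subst Unique T′≡ (∖-unique x unique)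
        T′≤ℓ : length T′ ℕ.≤ ℓ
        T′≤ℓ = ℕ.≤-trans (subst (λ T′ → length T′ ℕ.≤ length T) T′≡ (length-filter _ T)) T≤ℓ
        onward : 1ℚ + E ≤ coverBy (suc j) T x
        onward = subst (λ T′ → 1ℚ + expectation (step x) (coverBy j T′) ≤ coverBy (suc j) T x) T′≡
          (coverBy-step j T x (T′⊆T∖x (here refl)))
        IH : ∀ y → ℕ→ℚ j + Φ T′ y ≤ ℕ→ℚ M + (coverBy j T′ y + coverBy j T′ y)
        IH y = subst₂ _≤_ (ℚ.+-comm (Φ T′ y) (ℕ→ℚ j)) (ℚ.+-comm (coverBy j T′ y + coverBy j T′ y) (ℕ→ℚ M))
          (≤-trans (ℚ.+-monoˡ-≤ (ℕ→ℚ j) (Φ-remove y unique′ T′⊆A))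
                   (cover-lower j (ℕ.<⇒≤ j<M) y unique′ T′⊆A T′≤ℓ))

-- Minima, bounds and the growth of harmonic numbers

module ℚ-Extrema = Extrema (DecTotalOrder.totalOrder ℚ.≤-decTotalOrder)

minimizer : ∀ {A : Set} (f : A → ℚ) x xs → ∃[ s ] (s ∈ x ∷ xs × (∀ {v} → v ∈ x ∷ xs → f s ≤ f v))
minimizer f x xs = s , s∈ (ℚ-Extrema.argmin-sel f x xs) , minimal
  where
  s = ℚ-Extrema.argmin f x xs
  s∈ : s ≡ x ⊎ s ∈ xs → s ∈ x ∷ xs
  s∈ (inj₁ s≡x)  = here s≡x
  s∈ (inj₂ s∈xs) = there s∈xs
  minimal : ∀ {v} → v ∈ x ∷ xs → f s ≤ f v
  minimal (here refl)  = ℚ-Extrema.f[argmin]≤f[⊤] {f = f} x xs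
  minimal (there v∈xs) = All.lookup (ℚ-Extrema.f[argmin]≤f[xs] {f = f} x xs) v∈xs

bounded : ∀ {n} (f : Fin n → ℚ) → ∃[ M ] (∀ x → f x ≤ ℕ→ℚ M)
bounded {zero}  f = 0 , λ ()
bounded {suc n} f with ℚ-archimedean (f zero) | bounded (f ∘ suc)
... | M₀ , f₀≤M₀ | M , f≤M = M₀ ℕ.+ M , λ where
  zero    → ≤-trans f₀≤M₀ (ℕ→ℚ-mono-≤ (ℕ.m≤m+n M₀ M))
  (suc x) → ≤-trans (f≤M x) (ℕ→ℚ-mono-≤ (ℕ.m≤n+m M M₀))

bounded₂ : ∀ {m n} (f : Fin m → Fin n → ℚ) → ∃[ M ] (∀ x y → f x y ≤ ℕ→ℚ M)
bounded₂ f = let M , b≤M = bounded (λ x → ℕ→ℚ (proj₁ (bounded (f x)))) in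
  M , λ x y → ≤-trans (proj₂ (bounded (f x)) y) (b≤M x)

harmonic-1-mono : ∀ m i → harmonic-1 m ≤ harmonic-1 (i ℕ.+ m)
harmonic-1-mono m zero    = ≤-refl
harmonic-1-mono m (suc i) = ≤-trans (harmonic-1-mono m i) (grow (i ℕ.+ m))
  where
  grow : ∀ k → harmonic-1 k ≤ harmonic-1 (suc k)
  grow zero    = ≤-refl
  grow (suc k) = p≤p+q (0≤1/suc (suc k))

-- Oresme's grouping: the `suc m` additional terms are each at least the last one, 1/(2m + 2), so
-- together they are at least `½`.
harmonic-1-double : ∀ m → ½ + harmonic-1 (suc m) ≤ harmonic-1 (suc m ℕ.+ suc m)
harmonic-1-double m = ≤-trans (≤-reflexive (cong (_+ harmonic-1 (suc m)) (sym half))) (block (suc m) ℕ.≤-refl)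
  where
  r = 1/suc (m ℕ.+ suc m)
  half : ℕ→ℚ (suc m) * r ≡ ½
  half = double-injective (trans (trans (identity (ℕ→ℚ (suc m)) r) (cong (r *_) (sym (ℕ→ℚ-+ (suc m) (suc m))))) (1/suc-inverse (m ℕ.+ suc m)))
    where
    identity : ∀ p r → p * r + p * r ≡ r * (p + p)
    identity = solve-∀ ring
  block : ∀ i → i ℕ.≤ suc m → ℕ→ℚ i * r + harmonic-1 (suc m) ≤ harmonic-1 (i ℕ.+ suc m)
  block zero    _   = ≤-reflexive (trans (cong (_+ harmonic-1 (suc m)) (ℚ.*-zeroˡ r)) (ℚ.+-identityˡ (harmonic-1 (suc m))))
  block (suc i) i≤m = ≤-trans (≤-reflexive (trans (cong (λ z → z * r + harmonic-1 (suc m)) (ℕ→ℚ-suc i)) (identity (ℕ→ℚ i) r (harmonic-1 (suc m)))))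
    (≤-trans (+-mono-≤ (block i (ℕ.<⇒≤ i≤m)) (1/suc-antimono {i ℕ.+ suc m} {m ℕ.+ suc m} (ℕ.+-monoˡ-≤ (suc m) (ℕ.s≤s⁻¹ i≤m))))
             (≤-reflexive (extend i)))
    where
    identity : ∀ p r h → (1ℚ + p) * r + h ≡ (p * r + h) + r
    identity = solve-∀ ring
    extend : ∀ i → harmonic-1 (i ℕ.+ suc m) + 1/suc (i ℕ.+ suc m) ≡ harmonic-1 (suc (i ℕ.+ suc m))
    extend i rewrite ℕ.+-suc i m = refl

harmonic-1-dyadic : ∀ j → ½ * ℕ→ℚ j ≤ harmonic-1 (2 ℕ.^ j)
harmonic-1-dyadic zero    = ≤-refl
harmonic-1-dyadic (suc j) = ≤-trans (≤-reflexive (trans (cong (½ *_) (ℕ→ℚ-suc j)) (identity (ℕ→ℚ j))))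
  (≤-trans (ℚ.+-monoʳ-≤ ½ (harmonic-1-dyadic j)) (double (2 ℕ.^ j) {{ℕ.m^n≢0 2 j}}))
  where
  identity : ∀ p → ½ * (1ℚ + p) ≡ ½ + ½ * p
  identity = solve-∀ ring
  double : ∀ m .{{_ : ℕ.NonZero m}} → ½ + harmonic-1 m ≤ harmonic-1 (2 ℕ.* m)
  double (suc m) = subst (λ k → ½ + harmonic-1 (suc m) ≤ harmonic-1 (suc m ℕ.+ k)) (sym (ℕ.+-identityʳ (suc m))) (harmonic-1-double m)

uniform-nonempty-isProbability : ∀ {A : Set} {x : A} {xs} → x ∈ xs → IsProbability (uniform xs)
uniform-nonempty-isProbability {xs = x ∷ xs} _ = uniform-isProbability x xs

length*expectation-uniform : ∀ {A : Set} (F : A → ℚ) xs → ℕ→ℚ (length xs) * expectation (uniform xs) F ≡ sumℚ (List.map F xs)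
length*expectation-uniform F []       = refl
length*expectation-uniform F (x ∷ xs) = trans (cong (k *_) (expectation-uniform F x xs)) (trans (assoc k (1/suc (length xs)) s)
  (trans (cong (_* s) (1/suc-inverse (length xs))) (ℚ.*-identityˡ s)))
  where
  k = ℕ→ℚ (suc (length xs))
  s = sumℚ (List.map F (x ∷ xs))
  assoc : ∀ k r s → k * (r * s) ≡ (r * k) * s
  assoc = solve-∀ ring

distinctVertex : ∀ {n} → 2 ℕ.≤ n → ∀ (x : Fin n) → ∃[ y ] x ≢ y
distinctVertex (ℕ.s≤s (ℕ.s≤s _)) zero    = suc zero , λ ()
distinctVertex (ℕ.s≤s (ℕ.s≤s _)) (suc x) = zero , λ ()

-- The random walk and Matthews' lower bound

module Walk {n : ℕ} (2≤n : 2 ℕ.≤ n) (G : Graph n) where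
  open Graph G
  open Potential G
  open Distance G

  neighbour : ∀ x → ∃[ y ] Adj x y
  neighbour x with distinctVertex 2≤n x
  ... | y , x≢y = first (connected x y) x≢y
    where
    first : ∀ {x y} → Star Adj x y → x ≢ y → ∃[ z ] Adj x z
    first ε        x≢x = contradiction refl x≢x
    first (xz ◅ _) _   = _ , xz

  ∈-neighbours : ∀ {x y} → Adj x y → y ∈ neighbours x
  ∈-neighbours {x} {y} xy = ∈-filter⁺ (adj? x) (∈-allFin y) xy

  walkStep-isProbability : ∀ x → IsProbability (walkStep G x)
  walkStep-isProbability x = uniform-nonempty-isProbability (∈-neighbours (proj₂ (neighbour x)))

  deg≡degree : ∀ x → ℕ→ℚ (degree x) ≡ deg x
  deg≡degree x = trans (sym (ℚ.*-identityʳ (ℕ→ℚ (degree x)))) (trans (sym (sumℚ-const 1ℚ (neighbours x)))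
    (trans (sumℚ-filter-allFin (adj? x) (λ _ → 1ℚ)) (sum-cong-≗ λ y → ℚ.*-identityʳ (a x y))))

  deg*average : ∀ x F → deg x * expectation (walkStep G x) F ≡ sum (λ y → a x y * F y)
  deg*average x F = trans (cong (_* expectation (walkStep G x) F) (sym (deg≡degree x)))
    (trans (length*expectation-uniform F (neighbours x)) (sumℚ-filter-allFin (adj? x) F))

  1≤deg : ∀ x → 1ℚ ≤ deg x
  1≤deg x = let y , xy = neighbour x in subst (_≤ deg x) (a-adj xy) (term≤∑ (0≤a x) y)

  0<deg : ∀ x → 0ℚ < deg x
  0<deg x = ℚ.<-≤-trans 0<1 (1≤deg x)

  0<volume : 0ℚ < volume
  0<volume = ℚ.<-≤-trans (0<deg x₀) (term≤∑ (λ x → <⇒≤ (0<deg x)) x₀)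
    where
    x₀ : Fin n
    x₀ = Fin.fromℕ< (ℕ.≤-trans (ℕ.s≤s ℕ.z≤n) 2≤n)

  *-cancelˡ-≡ : ∀ {r p q} → 0ℚ < r → r * p ≡ r * q → p ≡ q
  *-cancelˡ-≡ 0<r e = ℚ.≤-antisym (*-cancelˡ-≤ 0<r (≤-reflexive e)) (*-cancelˡ-≤ 0<r (≤-reflexive (sym e)))

  H-step : ∀ v {x} → x ≢ v → H v x ≡ 1ℚ + expectation (walkStep G x) (H v)
  H-step v {x} x≢v = *-cancelˡ-≡ (0<deg x) (begin
    d * H v x                                  ≡⟨ restore (d * H v x) s ⟩
    (d * H v x - s) + s                        ≡⟨ cong₂ _+_ (trans (sym (L-expand (H v) x)) (H-off v x≢v)) (sym (deg*average x (H v))) ⟩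
    d + d * E                                  ≡⟨ factor d E ⟩
    d * (1ℚ + E)                               ∎)
    where
    open ≡-Reasoning
    d = deg x
    E = expectation (walkStep G x) (H v)
    s = sum (λ y → a x y * H v y)
    restore : ∀ p q → p ≡ (p - q) + q
    restore = solve-∀ ring
    factor : ∀ d e → d + d * e ≡ d * (1ℚ + e)
    factor = solve-∀ ring

  -- The mean hitting time of v from the stationary distribution.
  h : Fin n → ℚ
  h v = (ℚ.1/ volume) {{ℚ.>-nonZero 0<volume}} * ⟨ H v , deg ⟩

  h-difference : ∀ u v → h v - h u ≡ H v u - H u v
  h-difference u v = *-cancelˡ-≡ 0<volume (trans (factor volume r ⟨ H v , deg ⟩ ⟨ H u , deg ⟩)
    (trans (cong (_* (⟨ H v , deg ⟩ - ⟨ H u , deg ⟩)) (ℚ.*-inverseʳ volume {{ℚ.>-nonZero 0<volume}}))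
    (trans (ℚ.*-identityˡ _) (sym (H-reversal u v)))))
    where
    r = (ℚ.1/ volume) {{ℚ.>-nonZero 0<volume}}
    factor : ∀ w r p q → w * (r * p - r * q) ≡ (w * r) * (p - q)
    factor = solve-∀ ring

  coverTime : ℕ → Fin n → ℚ
  coverTime N s = expectation (trajectory (walkStep G) N s) (λ xs → ℕ→ℚ (least (covered? xs)))

  module _ (A : List (Fin n)) (unique : Unique A) (K : ℚ) (0≤K : 0ℚ ≤ K)
    (K+K≤commute : ∀ {u v} → u ∈ A → v ∈ A → u ≢ v → K + K ≤ commute u v)
    (s : Fin n) (s∈A : s ∈ A) (s-minimal : ∀ {v} → v ∈ A → h s ≤ h v)
    where

    -- The shift that makes the potential terms telescope: since `H v u` is half of
    -- `commute u v + h v - h u`, adding `b v` turns it into half the commute time plus `b u`. It is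
    -- nonpositive because `s` minimizes `h` on `A`.
    b : Fin n → ℚ
    b v = ½ * (h s - h v)

    g : Fin n → Fin n → ℚ
    g v x = b v + H v x

    g-step : ∀ {v x} → x ≢ v → g v x ≤ 1ℚ + expectation (walkStep G x) (g v)
    g-step {v} {x} x≢v = ≤-reflexive (trans (cong (b v +_) (H-step v x≢v)) (trans (exchange (b v) (expectation (walkStep G x) (H v)))
      (cong (1ℚ +_) (sym (expectation-shift (walkStep-isProbability x) (b v) (H v))))))
      where
      exchange : ∀ p e → p + (1ℚ + e) ≡ 1ℚ + (p + e)
      exchange = solve-∀ ring

    g-far : ∀ {u v} → u ∈ A → v ∈ A → u ≢ v → K + b u ≤ g v u
    g-far {u} {v} u∈A v∈A u≢v = ≤-by (½ * (commute u v - (K + K))) (0≤* 0≤½ (≤⇒0≤- (K+K≤commute u∈A v∈A u≢v)))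
      (trans (split (h s) (h v) (h u) (H v u)) (trans (cong (λ z → (½ * (h s - h u) + H v u) - ½ * z) (h-difference u v))
             (regroup (b u) (H v u) (H u v) K)))
      where
      split : ∀ c p q x → ½ * (c - p) + x ≡ (½ * (c - q) + x) - ½ * (p - q)
      split = solve-∀ ring
      regroup : ∀ b x y k → (b + x) - ½ * (x - y) ≡ (k + b) + ½ * ((x + y) - (k + k))
      regroup = solve-∀ ring

    g-self : ∀ v → g v v ≡ b v
    g-self v = trans (cong (b v +_) (H-target v)) (ℚ.+-identityʳ (b v))

    b≤0 : ∀ {v} → v ∈ A → b v ≤ 0ℚ
    b≤0 {v} v∈A = ≤-by (½ * (h v - h s)) (0≤* 0≤½ (≤⇒0≤- (s-minimal v∈A))) (cancel (h s) (h v))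
      where
      cancel : ∀ p q → 0ℚ ≡ ½ * (p - q) + ½ * (q - p)
      cancel = solve-∀ ring

    open Matthews (walkStep G) walkStep-isProbability A g b K 0≤K g-step g-far g-self b≤0

    -- There are finitely many values of `g`, and the harmonic term is at most `K` times the number
    -- of targets. The bound `M` also serves as the time horizon.
    Φ-bound : ∃[ M ] (∀ T x → length T ℕ.≤ length A → Φ T x ≤ ℕ→ℚ M)
    Φ-bound = let M , le = ℚ-archimedean (B + K * ℕ→ℚ (length A)) in
      M , λ T x T≤A → ≤-trans (+-mono-≤ (mean≤B T x) (*-monoˡ-≤ 0≤K (≤-trans (harmonic-1≤ (length T)) (ℕ→ℚ-mono-≤ T≤A)))) le
      where
      g≤B = bounded₂ g
      B = ℕ→ℚ (proj₁ g≤B)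
      mean≤B : ∀ T x → mean (length T) (S T x) ≤ B
      mean≤B []      x = 0≤ℕ→ℚ (proj₁ g≤B)
      mean≤B (v ∷ T) x = mean-upper (length T) (≤-trans (sumℚ-mono-≤ (v ∷ T) (λ {u} _ → proj₂ g≤B u x)) (≤-reflexive (sumℚ-const B (v ∷ T))))

    -- As `b s` is 0, every target other than `s` starts with `g v s ≥ K`; the mean thus contributes
    -- the leading term 1 of the harmonic number.
    Φ-start : ∀ k → length (A ∖ s) ≡ suc k → K * (1ℚ + harmonic-1 (suc k)) ≤ Φ (A ∖ s) s
    Φ-start k eq = ≤-trans (≤-reflexive (trans (ℚ.*-distribˡ-+ K 1ℚ (harmonic-1 (suc k))) (cong (_+ K * harmonic-1 (suc k)) (ℚ.*-identityʳ K))))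
      (subst (λ j → K + K * harmonic-1 (suc k) ≤ mean j (S (A ∖ s) s) + K * harmonic-1 j) (sym eq)
        (ℚ.+-monoˡ-≤ (K * harmonic-1 (suc k)) (≤-trans (≤-reflexive (sym (centred K (h s)))) (mean-lower k
          (subst (λ j → ℕ→ℚ j * (K + b s) ≤ S (A ∖ s) s) eq (S-far (A ∖ s) s∈A (∈-∖⁻ A)))))))
      where
      centred : ∀ k p → k + ½ * (p - p) ≡ k
      centred = solve-∀ ring

    coverBy≤coverTime : ∀ N → coverBy N A s ≤ coverTime N s
    coverBy≤coverTime N = expectation-mono (trajectory-isProbability (walkStep G) walkStep-isProbability N s) λ xs →
      ℕ→ℚ-mono-≤ {least (allVisited? A xs)} {least (covered? xs)}
        (least-mono (covered? xs) (allVisited? A xs) λ t covered → All.tabulate λ {v} _ → covered v)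

    cover-lower-from-minimizer : ∀ k → length (A ∖ s) ≡ suc k → ∃[ N ] K * (1ℚ + harmonic-1 (suc k)) ≤ coverTime N s + coverTime N s
    cover-lower-from-minimizer k eq = M , ≤-trans (Φ-start k eq) (≤-trans
      -- At `j = M` the remaining time on the left equals the allowance `M` on the right.
      (cancel (cover-lower M (length A) Φ≤M M ℕ.≤-refl s unique (λ v∈A → v∈A) ℕ.≤-refl))
      (+-mono-≤ (coverBy≤coverTime M) (coverBy≤coverTime M)))
      where
      M = proj₁ Φ-bound
      Φ≤M = proj₂ Φ-bound
      restore : ∀ p q → (p + q) + - q ≡ p
      restore = solve-∀ ring
      cancel : ∀ {p q} → p + ℕ→ℚ M ≤ q + ℕ→ℚ M → p ≤ q
      cancel {p} {q} le = subst₂ _≤_ (restore p (ℕ→ℚ M)) (restore q (ℕ→ℚ M)) (ℚ.+-monoˡ-≤ (- ℕ→ℚ M) le)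

  abstract

    matthews : ∀ A → Unique A → ∀ k → length A ≡ suc (suc k) → ∀ K → 0ℚ ≤ K →
      (∀ {u v} → u ∈ A → v ∈ A → u ≢ v → K + K ≤ commute u v) →
      ∃[ s ] ∃[ N ] K * (1ℚ + harmonic-1 (suc k)) ≤ coverTime N s + coverTime N s
    matthews A@(x ∷ xs) unique k eq K 0≤K K+K≤commute =
      let s , s∈A , s-minimal = minimizer h x xs in
      s , cover-lower-from-minimizer A unique K 0≤K K+K≤commute s s∈A s-minimal k
            (ℕ.suc-injective (trans (sym (length-∖ unique s∈A)) eq))

-- Lower bounds of order n log n and D² for the cover time

⅛ : ℚ
⅛ = ½ * (½ * ½)

module CoverBounds {n : ℕ} (2≤n : 2 ℕ.≤ n) (G : Graph n) where
  open Graph G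
  open Potential G
  open Distance G
  open Walk 2≤n G

  commute-sym : ∀ u v → commute u v ≡ commute v u
  commute-sym u v = ℚ.+-comm (H v u) (H u v)

  commute-dist : ∀ u v → ℕ→ℚ (dist v u) * ℕ→ℚ (dist v u) + ℕ→ℚ (dist v u) * ℕ→ℚ (dist v u) ≤ commute u v
  commute-dist u v = *-cancelˡ-≤ 0<volume (≤-by
    (½ * ((volume * κ + volume * κ) + t * t * e - (t + t) * (volume * (f u - f v) + volume * (f u - f v))) + ½ * (t * t) * (volume - e))
    (0≤+ (0≤* 0≤½ (≤⇒0≤- (dirichlet u v f t))) (0≤* (0≤* 0≤½ (0≤square t)) (≤⇒0≤- (energy-lipschitz f (dist-lipschitz v)))))
    (trans (identity volume κ e D) (cong (λ z → volume * (D * D + D * D) +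
      (½ * ((volume * κ + volume * κ) + t * t * e - (t + t) * (volume * z + volume * z)) + ½ * (t * t) * (volume - e)))
      (sym f-difference))))
    where
    D = ℕ→ℚ (dist v u)
    κ = commute u v
    -- The energy is at most `volume`, and this `t` maximizes 4tD - t².
    t = D + D
    f : Fin n → ℚ
    f x = ℕ→ℚ (dist v x)
    e = energy f f
    f-difference : f u - f v ≡ D
    f-difference = trans (cong (λ k → D - ℕ→ℚ k) (dist-self v)) (ℚ.+-identityʳ D)
    identity : ∀ w κ e D → w * κ ≡ w * (D * D + D * D) + (½ * ((w * κ + w * κ) + (D + D) * (D + D) * e -
      ((D + D) + (D + D)) * (w * D + w * D)) + ½ * ((D + D) * (D + D)) * (w - e))
    identity = solve-∀ ring

  commute-lowDegree : ∀ {u v} → ℕ→ℚ n * (⅛ * deg u) ≤ ½ * volume → u ≢ v → ⅛ * ℕ→ℚ n + ⅛ * ℕ→ℚ n ≤ commute u v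
  commute-lowDegree {u} {v} low u≢v = *-cancelˡ-≤ 0<volume (≤-by
    (½ * ((volume * κ + volume * κ) + t * t * e - (t + t) * (volume * (δ u u - δ u v) + volume * (δ u u - δ u v)))
      + ½ * (t * t) * ((deg u + deg u) - e) + ½ * m * (½ * volume - m * (⅛ * deg u)))
    (0≤+ (0≤+ (0≤* 0≤½ (≤⇒0≤- (dirichlet u v (δ u) t))) (0≤* (0≤* 0≤½ (0≤square t)) (≤⇒0≤- (energy-δ u))))
         (0≤* (0≤* 0≤½ (0≤ℕ→ℚ n)) (≤⇒0≤- low)))
    (trans (identity volume κ e m (deg u)) (cong (λ z → volume * (⅛ * m + ⅛ * m) + (½ * ((volume * κ + volume * κ) + t * t * e -
      (t + t) * (volume * z + volume * z)) + ½ * (t * t) * ((deg u + deg u) - e) + ½ * m * (½ * volume - m * (⅛ * deg u)))) (sym f-difference))))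
    where
    m = ℕ→ℚ n
    κ = commute u v
    t = ½ * (½ * m)
    e = energy (δ u) (δ u)
    f-difference : δ u u - δ u v ≡ 1ℚ
    f-difference = cong₂ _-_ (δ-same u) (δ-distinct u≢v)
    identity : ∀ w κ e m d → w * κ ≡ w * (⅛ * m + ⅛ * m) + (½ * ((w * κ + w * κ) + (½ * (½ * m)) * (½ * (½ * m)) * e -
      ((½ * (½ * m)) + (½ * (½ * m))) * (w * 1ℚ + w * 1ℚ)) + ½ * ((½ * (½ * m)) * (½ * (½ * m))) * ((d + d) - e) + ½ * m * (½ * w - m * (⅛ * d)))
    identity = solve-∀ ring

  -- Matthews' bound for the two targets `u` and `v`, where the harmonic factor is just 1.
  cover-distance : ∀ u v → u ≢ v → ∃[ s ] ∃[ N ] ℕ→ℚ (dist v u) * ℕ→ℚ (dist v u) ≤ coverTime N s + coverTime N s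
  cover-distance u v u≢v = let s , N , le = matthews (u ∷ v ∷ []) ((u≢v ∷ []) ∷ [] ∷ []) 0 refl (D * D) (0≤square D) pairs in
    s , N , ≤-trans (≤-reflexive (sym (ℚ.*-identityʳ (D * D)))) le
    where
    D = ℕ→ℚ (dist v u)
    pairs : ∀ {x y} → x ∈ u ∷ v ∷ [] → y ∈ u ∷ v ∷ [] → x ≢ y → D * D + D * D ≤ commute x y
    pairs (here refl)         (here refl)         x≢y = contradiction refl x≢y
    pairs (here refl)         (there (here refl)) x≢y = commute-dist u v
    pairs (there (here refl)) (here refl)         x≢y = ≤-trans (commute-dist u v) (≤-reflexive (commute-sym u v))
    pairs (there (here refl)) (there (here refl)) x≢y = contradiction refl x≢y

  abstract

    diameter : ∃[ u ] ∃[ v ] (u ≢ v × (∀ x y → dist y x ℕ.≤ dist v u))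
    diameter = u , v , u≢v , maximal
      where
      f : Fin n × Fin n → ℕ
      f (x , y) = dist y x
      pairs : List (Fin n × Fin n)
      pairs = cartesianProduct (allFin n) (allFin n)
      x₀ : Fin n
      x₀ = Fin.fromℕ< (ℕ.≤-trans (ℕ.s≤s ℕ.z≤n) 2≤n)
      best : Fin n × Fin n
      best = argmax f (x₀ , x₀) pairs
      u v : Fin n
      u = proj₁ best
      v = proj₂ best
      maximal : ∀ x y → dist y x ℕ.≤ dist v u
      maximal x y = All.lookup (f[xs]≤f[argmax] {f = f} (x₀ , x₀) pairs) (∈-cartesianProduct⁺ (∈-allFin x) (∈-allFin y))
      u≢v : u ≢ v
      u≢v u≡v = let y , x₀≢y = distinctVertex 2≤n x₀ in
        x₀≢y (dist≡0⇒≡ y x₀ (ℕ.n≤0⇒n≡0 (subst (dist y x₀ ℕ.≤_) (trans (cong (dist v) u≡v) (dist-self v)) (maximal x₀ y))))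

  -- That is, the degree is at most four times the average degree volume / n.
  lowDegree? : U.Decidable (λ x → ℕ→ℚ n * (⅛ * deg x) ≤ ½ * volume)
  lowDegree? x = ℕ→ℚ n * (⅛ * deg x) ℚ.≤? ½ * volume

  lowDegrees : List (Fin n)
  lowDegrees = filter lowDegree? (allFin n)

  -- Markov's inequality for the degrees.
  3n≤4∣lowDegrees∣ : 3 ℕ.* n ℕ.≤ 4 ℕ.* length lowDegrees
  3n≤4∣lowDegrees∣ = ℕ→ℚ-cancel-≤ (subst₂ _≤_ (sym (ℕ→ℚ-* 3 n)) (sym (ℕ→ℚ-* 4 (length lowDegrees)))
    (*-cancelˡ-≤ 0<volume (≤-by (ℕ→ℚ 8 * (m * (⅛ * volume) - (m - A) * (½ * volume))) (0≤* (0≤ℕ→ℚ 8) (≤⇒0≤- markov)) (identity volume m A))))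
    where
    m = ℕ→ℚ n
    A = ℕ→ℚ (length lowDegrees)
    ind : Fin n → ℚ
    ind x = indicator (does (lowDegree? x))
    ∑ind : sum ind ≡ A
    ∑ind = trans (sum-cong-≗ (λ x → sym (ℚ.*-identityʳ (ind x)))) (trans (sym (sumℚ-filter-allFin lowDegree? (λ _ → 1ℚ)))
      (trans (sumℚ-const 1ℚ lowDegrees) (ℚ.*-identityʳ A)))
    vanish : ∀ p → p * (1ℚ - 1ℚ) ≡ 0ℚ
    vanish = solve-∀ ring
    keep : ∀ p → p * (1ℚ - 0ℚ) ≡ p
    keep = solve-∀ ring
    pointwise : ∀ x → ½ * volume * (1ℚ - ind x) ≤ m * ⅛ * deg x
    pointwise x = cases (lowDegree? x)
      where
      cases : (low? : Dec (ℕ→ℚ n * (⅛ * deg x) ≤ ½ * volume)) → ½ * volume * (1ℚ - indicator (does low?)) ≤ m * ⅛ * deg x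
      cases (yes _)   = ≤-trans (≤-reflexive (vanish (½ * volume))) (0≤* (0≤* (0≤ℕ→ℚ n) (ℚ.nonNegative⁻¹ ⅛)) (<⇒≤ (0<deg x)))
      cases (no ¬low) = ≤-trans (≤-reflexive (keep (½ * volume))) (≤-trans (<⇒≤ (ℚ.≰⇒> ¬low)) (≤-reflexive (sym (ℚ.*-assoc m ⅛ (deg x)))))
    markov : (m - A) * (½ * volume) ≤ m * (⅛ * volume)
    markov = subst₂ _≤_
      (trans (∑-scale (½ * volume) (λ x → 1ℚ - ind x)) (trans (ℚ.*-comm (½ * volume) _) (cong (_* (½ * volume))
        (trans (∑-sub (λ _ → 1ℚ) ind) (cong₂ _-_ (trans (∑-const n 1ℚ) (ℚ.*-identityʳ m)) ∑ind)))))
      (trans (∑-scale (m * ⅛) deg) (ℚ.*-assoc m ⅛ volume))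
      (∑-mono-≤ pointwise)
    identity : ∀ w m A → w * (ℕ→ℚ 4 * A) ≡ w * (ℕ→ℚ 3 * m) + ℕ→ℚ 8 * (m * (⅛ * w) - (m - A) * (½ * w))
    identity = solve-∀ ring

  -- One vertex is lost as the starting point. Since n ≥ 2 gives 3n ≥ n + 4, the bound 3n ≤ 4j for
  -- the size j yields n ≤ 4(j - 1), and in particular j ≥ 2.
  lowDegrees-size : ∃[ k ] (length lowDegrees ≡ suc (suc k) × n ℕ.≤ 4 ℕ.* suc k)
  lowDegrees-size = go (length lowDegrees) refl 3n≤4∣lowDegrees∣
    where
    n+4≤3n : n ℕ.+ 4 ℕ.≤ 3 ℕ.* n
    n+4≤3n = ℕ.+-monoʳ-≤ n (ℕ.+-mono-≤ 2≤n (ℕ.+-mono-≤ 2≤n (ℕ.z≤n {0})))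
    bound : ∀ j → 3 ℕ.* n ℕ.≤ 4 ℕ.* suc j → n ℕ.≤ 4 ℕ.* j
    bound j le = ℕ.+-cancelʳ-≤ 4 n (4 ℕ.* j) (ℕ.≤-trans n+4≤3n (ℕ.≤-trans le (ℕ.≤-reflexive (trans (ℕ.*-suc 4 j) (ℕ.+-comm 4 (4 ℕ.* j))))))
    go : ∀ j → length lowDegrees ≡ j → 3 ℕ.* n ℕ.≤ 4 ℕ.* j → ∃[ k ] (length lowDegrees ≡ suc (suc k) × n ℕ.≤ 4 ℕ.* suc k)
    go zero          _  le = contradiction (ℕ.≤-trans (ℕ.≤-trans (ℕ.m≤n+m 4 n) n+4≤3n) le) λ ()
    go (suc zero)    _  le = contradiction (ℕ.≤-trans 2≤n (bound 0 le)) λ ()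
    go (suc (suc k)) eq le = k , eq , bound (suc k) le

  -- The factor 4 costs two powers of 2, so the dyadic estimate applies to L - 2; the leading 1
  -- makes up for the missing ½ * 2. For `L = 1` it suffices alone.
  harmonic-lower : ∀ {L} k → 1 ℕ.≤ L → 2 ℕ.^ L ℕ.≤ 4 ℕ.* suc k → ½ * ℕ→ℚ L ≤ 1ℚ + harmonic-1 (suc k)
  harmonic-lower {suc zero} k _ _ = ≤-trans (*-monoˡ-≤ 0≤½ (≤-refl {1ℚ})) (≤-trans ½≤1
    (p≤p+q (subst (λ j → 0ℚ ≤ harmonic-1 j) (ℕ.+-comm k 1) (harmonic-1-mono 1 k))))
    where
    ½≤1 : ½ * 1ℚ ≤ 1ℚ
    ½≤1 = ≤-by ½ 0≤½ refl
  harmonic-lower {suc (suc j)} k _ le = ≤-trans (≤-reflexive (trans (cong (½ *_) (ℕ→ℚ-+ 2 j)) (identity (ℕ→ℚ j))))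
    (ℚ.+-monoʳ-≤ 1ℚ (≤-trans (harmonic-1-dyadic j)
      (subst (λ i → harmonic-1 (2 ℕ.^ j) ≤ harmonic-1 i) (ℕ.m∸n+n≡m 2^j≤k) (harmonic-1-mono (2 ℕ.^ j) (suc k ℕ.∸ 2 ℕ.^ j)))))
    where
    2^j≤k : 2 ℕ.^ j ℕ.≤ suc k
    2^j≤k = ℕ.*-cancelˡ-≤ 4 (subst (ℕ._≤ 4 ℕ.* suc k) (sym (ℕ.*-assoc 2 2 (2 ℕ.^ j))) le)
    identity : ∀ p → ½ * (ℕ→ℚ 2 + p) ≡ 1ℚ + ½ * p
    identity = solve-∀ ring

  cover-nlogn : ∀ {L} → 1 ℕ.≤ L → 2 ℕ.^ L ℕ.≤ n → ∃[ s ] ∃[ N ] (⅛ * ℕ→ℚ n) * (½ * ℕ→ℚ L) ≤ coverTime N s + coverTime N s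
  cover-nlogn {L} 1≤L 2^L≤n =
    let k , size , n≤4k = lowDegrees-size
        s , N , le = matthews lowDegrees (Unique.filter⁺ lowDegree? (Unique.allFin⁺ n)) k size (⅛ * ℕ→ℚ n) 0≤K
                       (λ u∈ _ u≢v → commute-lowDegree (proj₂ (∈-filter⁻ lowDegree? {xs = allFin n} u∈)) u≢v)
    in s , N , ≤-trans (*-monoˡ-≤ 0≤K (harmonic-lower k 1≤L (ℕ.≤-trans 2^L≤n n≤4k))) le
    where
    0≤K : 0ℚ ≤ ⅛ * ℕ→ℚ n
    0≤K = 0≤* (ℚ.nonNegative⁻¹ ⅛) (0≤ℕ→ℚ n)

-- The push algorithm

pow2 : ℕ → ℚ
pow2 k = ℕ→ℚ (2 ℕ.^ k)

½^_ : ℕ → ℚ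
½^ zero    = 1ℚ
½^ (suc k) = ½ * ½^ k

pow2-suc : ∀ k → pow2 (suc k) ≡ pow2 k + pow2 k
pow2-suc k = trans (ℕ→ℚ-* 2 (2 ℕ.^ k)) (double (pow2 k))
  where
  double : ∀ p → ℕ→ℚ 2 * p ≡ p + p
  double = solve-∀ ring

½^*pow2 : ∀ k → ½^ k * pow2 k ≡ 1ℚ
½^*pow2 zero    = refl
½^*pow2 (suc k) = trans (cong (½ * ½^ k *_) (pow2-suc k)) (trans (halve (½^ k) (pow2 k)) (½^*pow2 k))
  where
  halve : ∀ p q → ½ * p * (q + q) ≡ p * q
  halve = solve-∀ ring

0≤½^ : ∀ k → 0ℚ ≤ ½^ k
0≤½^ zero    = 0≤1
0≤½^ (suc k) = 0≤* 0≤½ (0≤½^ k)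

-- The value at 0 drops informed vertices from the sum Ψ, and makes the step from distance 1 to 0 a
-- halving at least, like all the others.
weight : ℕ → ℚ
weight zero    = 0ℚ
weight (suc k) = pow2 k

weight-suc : ∀ k → weight k ≤ weight (suc k)
weight-suc zero    = 0≤1
weight-suc (suc k) = ≤-trans (p≤p+q (0≤ℕ→ℚ (2 ℕ.^ k))) (≤-reflexive (sym (pow2-suc k)))

weight-mono : ∀ {j k} → j ℕ.≤ k → weight j ≤ weight k
weight-mono {j} j≤k = go (ℕ.≤⇒≤′ j≤k)
  where
  go : ∀ {k} → j ℕ.≤′ k → weight j ≤ weight k
  go (ℕ.≤′-reflexive refl) = ≤-refl
  go (ℕ.≤′-step {k} p)     = ≤-trans (go p) (weight-suc k)

0≤weight : ∀ k → 0ℚ ≤ weight k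
0≤weight k = weight-mono {0} {k} ℕ.z≤n

weight≤half : ∀ k → weight k ≤ weight (suc k) - ½ * weight (suc k)
weight≤half zero    = ≤-by ½ 0≤½ refl
weight≤half (suc k) = ≤-reflexive (sym (trans (cong (λ p → p - ½ * p) (pow2-suc k)) (halve (pow2 k))))
  where
  halve : ∀ p → (p + p) - ½ * (p + p) ≡ p
  halve = solve-∀ ring

expectation-independent-∷ : ∀ {A : Set} (d : Dist A) ds F →
  expectation (independent (d ∷ ds)) F ≡ expectation d (λ x → expectation (independent ds) (λ xs → F (x ∷ xs)))
expectation-independent-∷ d ds F = trans (expectation->>= d _ F) (expectation-cong d λ x →
  trans (expectation->>= (independent ds) _ F) (expectation-cong (independent ds) λ xs → expectation-return (x ∷ xs) F))

independent-isProbability : ∀ {A B : Set} {f : B → Dist A} → (∀ x → IsProbability (f x)) → ∀ xs → IsProbability (independent (List.map f xs))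
independent-isProbability P []       = return-isProbability []
independent-isProbability P (x ∷ xs) = >>=-isProbability (P x) λ y →
  >>=-isProbability (independent-isProbability P xs) λ ys → return-isProbability (y ∷ ys)

module Push {n : ℕ} (2≤n : 2 ℕ.≤ n) (G : Graph n) (Δ-1 : ℕ) (degree≤Δ : ∀ u → Graph.degree G u ℕ.≤ suc Δ-1) where
  open Graph G
  open Distance G
  open Walk 2≤n G

  -- The expectation of `δ y` is the probability of drawing `y`.
  expectation-δ : ∀ {y : Fin n} xs → y ∈ xs → length xs ℕ.≤ suc Δ-1 → 1/suc Δ-1 ≤ expectation (uniform xs) (δ y)
  expectation-δ {y} (x ∷ xs) y∈ len≤Δ = ≤-trans (1/suc-antimono (ℕ.s≤s⁻¹ len≤Δ))
    (≤-trans (≤-reflexive (sym (ℚ.*-identityʳ (1/suc (length xs)))))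
    (≤-trans (*-monoˡ-≤ (0≤1/suc (length xs)) (hit (x ∷ xs) y∈)) (≤-reflexive (sym (expectation-uniform (δ y) x xs)))))
    where
    0≤δ : ∀ z → 0ℚ ≤ δ y z
    0≤δ z = 0≤indicator (does (y Fin.≟ z))
    hit : ∀ zs → y ∈ zs → 1ℚ ≤ sumℚ (List.map (δ y) zs)
    hit (z ∷ zs) (here refl) = ≤-trans (≤-reflexive (sym (δ-same y))) (p≤p+q (sumℚ-nonneg {F = δ y} 0≤δ zs))
    hit (z ∷ zs) (there y∈)  = ≤-trans (hit zs y∈) (≤-by (δ y z) (0≤δ z) (ℚ.+-comm (δ y z) _))

  -- Only the choice made by `u` is examined: it hits `y` with probability at least 1/Δ and then
  -- saves `c`. The choices of all other informed vertices are averaged out against the uniform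
  -- bounds.
  push-to : ∀ {u y} us → u ∈ us → Adj u y → ∀ {B c} (F : List (Fin n) → ℚ) → 0ℚ ≤ c →
    (∀ vs → F vs ≤ B) → (∀ vs → y ∈ vs → F vs ≤ B - c) →
    expectation (independent (List.map (walkStep G) us)) F ≤ B - 1/suc Δ-1 * c
  push-to {u} {y} (_ ∷ us) (here refl) uy {B} {c} F 0≤c F≤B F≤B-c = begin
    expectation (independent (List.map (walkStep G) (u ∷ us))) F
      ≡⟨ expectation-independent-∷ (walkStep G u) (List.map (walkStep G) us) F ⟩
    expectation (walkStep G u) (λ x → expectation (independent (List.map (walkStep G) us)) (λ xs → F (x ∷ xs)))
      ≤⟨ expectation-mono (walkStep-isProbability u) choice ⟩
    expectation (walkStep G u) (λ x → B + - c * δ y x)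
      ≡⟨ trans (expectation-shift (walkStep-isProbability u) B (λ x → - c * δ y x)) (cong (B +_) (expectation-scale (walkStep G u) (- c) (δ y))) ⟩
    B + - c * E
      ≤⟨ ≤-by (c * (E - 1/suc Δ-1)) (0≤* 0≤c (≤⇒0≤- (expectation-δ (neighbours u) (∈-neighbours uy) (degree≤Δ u)))) (identity B c E (1/suc Δ-1)) ⟩
    B - 1/suc Δ-1 * c ∎
    where
    open ℚ.≤-Reasoning
    E = expectation (walkStep G u) (δ y)
    P = independent-isProbability walkStep-isProbability us
    identity : ∀ B c E r → B - r * c ≡ (B + - c * E) + c * (E - r)
    identity = solve-∀ ring
    unit : ∀ B c → B - c ≡ B + - c * 1ℚ
    unit = solve-∀ ring
    null : ∀ B c → B ≡ B + - c * 0ℚ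
    null = solve-∀ ring
    choice : ∀ x → expectation (independent (List.map (walkStep G) us)) (λ xs → F (x ∷ xs)) ≤ B + - c * δ y x
    choice x with y Fin.≟ x
    ... | yes y≡x = ≤-trans (expectation-mono P (λ xs → F≤B-c (x ∷ xs) (here y≡x))) (≤-reflexive (trans (expectation-const P (B - c)) (unit B c)))
    ... | no _    = ≤-trans (expectation-mono P (λ xs → F≤B (x ∷ xs))) (≤-reflexive (trans (expectation-const P B) (null B c)))
  push-to {u} {y} (w ∷ us) (there u∈us) uy {B} {c} F 0≤c F≤B F≤B-c =
    ≤-trans (≤-reflexive (expectation-independent-∷ (walkStep G w) (List.map (walkStep G) us) F))
    (≤-trans (expectation-mono (walkStep-isProbability w) λ x →
      push-to us u∈us uy (λ xs → F (x ∷ xs)) 0≤c (λ xs → F≤B (x ∷ xs)) (λ xs y∈ → F≤B-c (x ∷ xs) (there y∈)))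
      (≤-reflexive (expectation-const (walkStep-isProbability w) (B - 1/suc Δ-1 * c))))

  informed : Subset n → List (Fin n)
  informed I = filter (_∈? I) (allFin n)

  choices : Subset n → Dist (List (Fin n))
  choices I = independent (List.map (walkStep G) (informed I))

  choices-isProbability : ∀ I → IsProbability (choices I)
  choices-isProbability I = independent-isProbability walkStep-isProbability (informed I)

  inform : Subset n → List (Fin n) → Subset n
  inform I vs = I ∪ ⋃ (List.map ⁅_⁆ vs)

  expectation-pushStep : ∀ I F → expectation (pushStep G I) F ≡ expectation (choices I) (λ vs → F (inform I vs))
  expectation-pushStep I F = trans (expectation->>= (choices I) _ F) (expectation-cong (choices I) λ vs → expectation-return (inform I vs) F)

  pushStep-isProbability : ∀ I → IsProbability (pushStep G I)
  pushStep-isProbability I = >>=-isProbability (choices-isProbability I) λ vs → return-isProbability (inform I vs)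

  inform-⊇ : ∀ I vs → I ⊆ inform I vs
  inform-⊇ I vs = p⊆p∪q (⋃ (List.map ⁅_⁆ vs))

  inform-∋ : ∀ I {y vs} → y ∈ vs → y ∈ˢ inform I vs
  inform-∋ I {y} {vs} y∈vs = q⊆p∪q I (⋃ (List.map ⁅_⁆ vs)) (union vs y∈vs)
    where
    union : ∀ vs → y ∈ vs → y ∈ˢ ⋃ (List.map ⁅_⁆ vs)
    union (v ∷ vs) (here refl) = p⊆p∪q (⋃ (List.map ⁅_⁆ vs)) (x∈⁅x⁆ y)
    union (v ∷ vs) (there y∈)  = q⊆p∪q ⁅ v ⁆ (⋃ (List.map ⁅_⁆ vs)) (union vs y∈)

  module Bound (D : ℕ) (dist≤D : ∀ v u → dist v u ℕ.≤ D) where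

    near? : ∀ v I (t : Fin (suc D)) → Dec (∃[ u ] (u ∈ˢ I × dist v u ℕ.≤ toℕ t))
    near? v I t = any? λ u → u ∈? I ×-dec dist v u ℕ.≤? toℕ t

    -- The search runs through 0, ..., D, and its default `suc D` arises only for empty `I`, since
    -- no distance exceeds `D`.
    distFrom : Subset n → Fin n → ℕ
    distFrom I v = least (near? v I)

    distFrom-anti : ∀ {I J} v → I ⊆ J → distFrom J v ℕ.≤ distFrom I v
    distFrom-anti {I} {J} v I⊆J = least-mono (near? v I) (near? v J) λ t (u , u∈I , le) → u , I⊆J u∈I , le

    distFrom≤dist : ∀ {I u} v → u ∈ˢ I → distFrom I v ℕ.≤ dist v u
    distFrom≤dist {I} {u} v u∈I = subst (distFrom I v ℕ.≤_) (toℕ-fromℕ< (ℕ.s≤s (dist≤D v u)))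
      (least-minimal (near? v I) (Fin.fromℕ< (ℕ.s≤s (dist≤D v u))) (u , u∈I , ℕ.≤-reflexive (sym (toℕ-fromℕ< (ℕ.s≤s (dist≤D v u))))))

    nearest : ∀ {I s} v → s ∈ˢ I → ∃[ u ] (u ∈ˢ I × dist v u ≡ distFrom I v)
    nearest {I} {s} v s∈I =
      let t , t≡ , u , u∈I , le = least-satisfies (near? v I) (ℕ.s≤s (ℕ.≤-trans (distFrom≤dist v s∈I) (dist≤D v s)))
      in u , u∈I , ℕ.≤-antisym (ℕ.≤-trans le (ℕ.≤-reflexive t≡)) (distFrom≤dist v u∈I)

    -- Let `u` be an informed vertex nearest to `v`, and `y` a neighbour of `u` closer to `v`. If
    -- `u` calls `y`, the distance drops and the weight at least halves; in any case it does not
    -- grow.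
    contraction : ∀ {I s} v → s ∈ˢ I →
      expectation (pushStep G I) (λ J → weight (distFrom J v)) ≤ weight (distFrom I v) - 1/suc Δ-1 * (½ * weight (distFrom I v))
    contraction {I} {s} v s∈I = ≤-trans (≤-reflexive (expectation-pushStep I (λ J → weight (distFrom J v)))) (go (distFrom I v) refl)
      where
      F : List (Fin n) → ℚ
      F vs = weight (distFrom (inform I vs) v)
      F≤ : ∀ vs → F vs ≤ weight (distFrom I v)
      F≤ vs = weight-mono (distFrom-anti v (inform-⊇ I vs))
      go : ∀ k → distFrom I v ≡ k → expectation (choices I) F ≤ weight k - 1/suc Δ-1 * (½ * weight k)
      go zero eq = ≤-trans (expectation-mono (choices-isProbability I) (λ vs → subst (λ k → F vs ≤ weight k) eq (F≤ vs)))
        (≤-reflexive (trans (expectation-const (choices-isProbability I) 0ℚ) (zeros (1/suc Δ-1))))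
        where
        zeros : ∀ r → 0ℚ ≡ 0ℚ - r * (½ * 0ℚ)
        zeros = solve-∀ ring
      go (suc k) eq =
        let u , u∈I , dist≡ = nearest v s∈I
            y , uy , y≤k = dist-closer v u (trans dist≡ eq)
        in push-to (informed I) (∈-filter⁺ (_∈? I) (∈-allFin u) u∈I) uy F (0≤* 0≤½ (0≤weight (suc k)))
             (λ vs → subst (λ k → F vs ≤ weight k) eq (F≤ vs))
             (λ vs y∈vs → ≤-trans (weight-mono (ℕ.≤-trans (distFrom≤dist v (inform-∋ I y∈vs)) y≤k)) (weight≤half k))

    Ψ : Subset n → ℚ
    Ψ I = sum λ v → weight (distFrom I v)

    0≤Ψ : ∀ I → 0ℚ ≤ Ψ I
    0≤Ψ I = ∑-nonneg λ v → 0≤weight (distFrom I v)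

    Ψ-contraction : ∀ {I s} → s ∈ˢ I → expectation (pushStep G I) Ψ ≤ Ψ I - 1/suc Δ-1 * ½ * Ψ I
    Ψ-contraction {I} s∈I = ≤-trans (≤-reflexive (expectation-∑ (pushStep G I) (λ v J → weight (distFrom J v))))
      (≤-trans (∑-mono-≤ (λ v → contraction v s∈I)) (≤-reflexive
        (trans (∑-sub (λ v → weight (distFrom I v)) (λ v → 1/suc Δ-1 * (½ * weight (distFrom I v))))
               (cong (λ z → Ψ I - z) (trans (sum-cong-≗ (λ v → sym (ℚ.*-assoc (1/suc Δ-1) ½ (weight (distFrom I v)))))
                 (∑-scale (1/suc Δ-1 * ½) (λ v → weight (distFrom I v))))))))

    uninformed : ∀ {I} → I ≢ full → ∃[ v ] v ∉ˢ I
    uninformed {I} I≢full = ¬∀⟶∃¬ n (_∈ˢ I) (_∈? I) λ all → I≢full (⊆-antisym ⊆⊤ (λ {v} _ → all v))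

    -- An uninformed vertex is at positive distance and so contributes at least `weight 1`, which is
    -- 1.
    1≤Ψ : ∀ {I s} → s ∈ˢ I → I ≢ full → 1ℚ ≤ Ψ I
    1≤Ψ {I} s∈I I≢full = let v , v∉I = uninformed I≢full in
      ≤-trans (weight-mono {1} (ℕ.n≢0⇒n>0 (λ d≡0 → let u , u∈I , dist≡ = nearest v s∈I in v∉I (subst (_∈ˢ I) (dist≡0⇒≡ v u (trans dist≡ d≡0)) u∈I))))
              (term≤∑ (λ v → 0≤weight (distFrom I v)) v)

    Ψ≤ : ∀ {I s} → s ∈ˢ I → Ψ I ≤ ℕ→ℚ n * pow2 D
    Ψ≤ {I} {s} s∈I = ≤-trans (∑-mono-≤ λ v → weight-mono {distFrom I v} {suc D}
        (ℕ.≤-trans (ℕ.≤-trans (distFrom≤dist v s∈I) (dist≤D v s)) (ℕ.n≤1+n D)))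
      (≤-reflexive (∑-const n (pow2 D)))

    pushTime : ℕ → Subset n → ℚ
    pushTime N I = expectation (trajectory (pushStep G) N I) (λ Is → ℕ→ℚ (least (allInformed? Is)))

    least-full : ∀ {N I} (Is : Vec (Subset n) N) → I ≡ full → least (allInformed? (I ∷ Is)) ≡ 0
    least-full {I = I} Is I≡full = cong (λ b → if b then 0 else suc (least (allInformed? Is))) (dec-true (allInformed? (I ∷ Is) zero) I≡full)

    least-not-full : ∀ {N I} (Is : Vec (Subset n) N) → I ≢ full → least (allInformed? (I ∷ Is)) ≡ suc (least (allInformed? Is))
    least-not-full {I = I} Is I≢full = cong (λ b → if b then 0 else suc (least (allInformed? Is))) (dec-false (allInformed? (I ∷ Is) zero) I≢full)

    pushTime-full : ∀ N {I} → I ≡ full → pushTime (suc N) I ≡ 0ℚ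
    pushTime-full N {I} I≡full = trans (expectation-trajectory (pushStep G) N I (λ Is → ℕ→ℚ (least (allInformed? Is))))
      (trans (expectation-cong (pushStep G I) (λ J → trans (expectation-cong (trajectory (pushStep G) N J) (λ Is → cong ℕ→ℚ (least-full Is I≡full)))
        (expectation-const (trajectory-isProbability (pushStep G) pushStep-isProbability N J) 0ℚ))) (expectation-const (pushStep-isProbability I) 0ℚ))

    pushTime-step : ∀ N {I} → I ≢ full → pushTime (suc N) I ≡ 1ℚ + expectation (pushStep G I) (pushTime N)
    pushTime-step N {I} I≢full = trans (expectation-trajectory (pushStep G) N I (λ Is → ℕ→ℚ (least (allInformed? Is))))
      (trans (expectation-cong (pushStep G I) (λ J → trans (expectation-cong (trajectory (pushStep G) N J) (λ Is →
          trans (cong ℕ→ℚ (least-not-full Is I≢full)) (ℕ→ℚ-suc (least (allInformed? Is)))))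
        (expectation-shift (trajectory-isProbability (pushStep G) pushStep-isProbability N J) 1ℚ (λ Is → ℕ→ℚ (least (allInformed? Is))))))
      (expectation-shift (pushStep-isProbability I) 1ℚ (pushTime N)))

    -- This is 2Δ, the reciprocal of the contraction rate of `Ψ`.
    X : ℚ
    X = ℕ→ℚ (suc Δ-1) + ℕ→ℚ (suc Δ-1)

    1≤X : 1ℚ ≤ X
    1≤X = ≤-trans (ℕ→ℚ-mono-≤ {1} {suc Δ-1} (ℕ.s≤s ℕ.z≤n)) (p≤p+q (0≤ℕ→ℚ (suc Δ-1)))

    0≤X : 0ℚ ≤ X
    0≤X = ≤-trans 0≤1 1≤X

    X*rate : X * (1/suc Δ-1 * ½) ≡ 1ℚ
    X*rate = trans (identity (ℕ→ℚ (suc Δ-1)) (1/suc Δ-1)) (1/suc-inverse Δ-1)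
      where
      identity : ∀ d r → (d + d) * (r * ½) ≡ r * d
      identity = solve-∀ ring

    -- The bound assumed at horizon `N` is affine in `Ψ`, so the contraction of the mean of `Ψ`
    -- carries over; because `X` is the reciprocal rate, the gain is exactly `½^ k * Ψ I`.
    push-mean : ∀ {I s} k N → s ∈ˢ I → (∀ {J} → s ∈ˢ J → pushTime N J ≤ X * (ℕ→ℚ k + ½^ k * Ψ J)) →
      expectation (pushStep G I) (pushTime N) ≤ X * (ℕ→ℚ k + ½^ k * Ψ I) - ½^ k * Ψ I
    push-mean {I} {s} k N s∈I IH = begin
      expectation (pushStep G I) (pushTime N)
        ≡⟨ expectation-pushStep I (pushTime N) ⟩
      expectation (choices I) (λ vs → pushTime N (inform I vs))
        ≤⟨ expectation-mono (choices-isProbability I) (λ vs → ≤-trans (IH (inform-⊇ I vs s∈I))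
             (≤-reflexive (distrib X (ℕ→ℚ k) (½^ k) (Ψ (inform I vs))))) ⟩
      expectation (choices I) (λ vs → X * ℕ→ℚ k + X * ½^ k * Ψ (inform I vs))
        ≡⟨ sym (expectation-pushStep I (λ J → X * ℕ→ℚ k + X * ½^ k * Ψ J)) ⟩
      expectation (pushStep G I) (λ J → X * ℕ→ℚ k + X * ½^ k * Ψ J)
        ≡⟨ trans (expectation-shift (pushStep-isProbability I) (X * ℕ→ℚ k) (λ J → X * ½^ k * Ψ J))
             (cong (X * ℕ→ℚ k +_) (expectation-scale (pushStep G I) (X * ½^ k) Ψ)) ⟩
      X * ℕ→ℚ k + X * ½^ k * expectation (pushStep G I) Ψ
        ≤⟨ ℚ.+-monoʳ-≤ (X * ℕ→ℚ k) (*-monoˡ-≤ (0≤* 0≤X (0≤½^ k)) (Ψ-contraction s∈I)) ⟩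
      X * ℕ→ℚ k + X * ½^ k * (Ψ I - 1/suc Δ-1 * ½ * Ψ I)
        ≡⟨ collect X (ℕ→ℚ k) (½^ k) (Ψ I) (1/suc Δ-1 * ½) ⟩
      X * (ℕ→ℚ k + ½^ k * Ψ I) - X * (1/suc Δ-1 * ½) * (½^ k * Ψ I)
        ≡⟨ cong (λ z → X * (ℕ→ℚ k + ½^ k * Ψ I) - z) (trans (cong (_* (½^ k * Ψ I)) X*rate) (ℚ.*-identityˡ (½^ k * Ψ I))) ⟩
      X * (ℕ→ℚ k + ½^ k * Ψ I) - ½^ k * Ψ I ∎
      where
      open ℚ.≤-Reasoning
      distrib : ∀ x k h p → x * (k + h * p) ≡ x * k + x * h * p
      distrib = solve-∀ ring
      collect : ∀ x k h p r → x * k + x * h * (p - r * p) ≡ x * (k + h * p) - x * r * (h * p)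
      collect = solve-∀ ring

    -- A family of affine functions in place of X log₂ Ψ: while Ψ ≥ 2^k the k-th one drops by at least 1 on
    -- average, and for smaller Ψ it dominates 1 plus the mean of the (k-1)-st one.
    push-upper : ∀ N k {I s} → s ∈ˢ I → pushTime N I ≤ X * (ℕ→ℚ k + ½^ k * Ψ I)
    push-upper zero    k {I} s∈I = 0≤* 0≤X (0≤+ (0≤ℕ→ℚ k) (0≤* (0≤½^ k) (0≤Ψ I)))
    push-upper (suc N) k {I} {s} s∈I = cases (≡full? I)
      where
      ≡full? : ∀ I → Dec (I ≡ full)
      ≡full? I = allInformed? (I ∷ []) zero
      same : I ≢ full → ∀ k → 1ℚ ≤ ½^ k * Ψ I → pushTime (suc N) I ≤ X * (ℕ→ℚ k + ½^ k * Ψ I)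
      same I≢full k large = ≤-trans (≤-reflexive (pushTime-step N I≢full)) (≤-trans (ℚ.+-monoʳ-≤ 1ℚ (push-mean k N s∈I (λ s∈J → push-upper N k s∈J)))
        (≤-by (½^ k * Ψ I - 1ℚ) (≤⇒0≤- large) (identity (X * (ℕ→ℚ k + ½^ k * Ψ I)) (½^ k * Ψ I))))
        where
        identity : ∀ b p → b ≡ (1ℚ + (b - p)) + (p - 1ℚ)
        identity = solve-∀ ring
      next : I ≢ full → ∀ k → ½^ (suc k) * Ψ I ≤ 1ℚ → pushTime (suc N) I ≤ X * (ℕ→ℚ (suc k) + ½^ (suc k) * Ψ I)
      next I≢full k small = ≤-trans (≤-reflexive (pushTime-step N I≢full)) (≤-trans (ℚ.+-monoʳ-≤ 1ℚ (push-mean k N s∈I (λ s∈J → push-upper N k s∈J)))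
        (≤-by ((X - 1ℚ) * (1ℚ - ½^ (suc k) * Ψ I) + ½^ (suc k) * Ψ I) (0≤+ (0≤* (≤⇒0≤- 1≤X) (≤⇒0≤- small)) (0≤* (0≤½^ (suc k)) (0≤Ψ I)))
          (trans (cong (λ z → X * (z + ½^ (suc k) * Ψ I)) (ℕ→ℚ-suc k)) (identity X (ℕ→ℚ k) (½^ k) (Ψ I)))))
        where
        identity : ∀ x k h p → x * ((1ℚ + k) + ½ * h * p) ≡ (1ℚ + (x * (k + h * p) - h * p)) + ((x - 1ℚ) * (1ℚ - ½ * h * p) + ½ * h * p)
        identity = solve-∀ ring
      notFull : I ≢ full → ∀ k → pushTime (suc N) I ≤ X * (ℕ→ℚ k + ½^ k * Ψ I)
      -- No function precedes the one with index 0, but `Ψ ≥ 1` already guarantees its drop.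
      notFull I≢full zero    = same I≢full 0 (≤-trans (1≤Ψ s∈I I≢full) (≤-reflexive (sym (ℚ.*-identityˡ (Ψ I)))))
      notFull I≢full (suc k) with ℚ.≤-total 1ℚ (½^ (suc k) * Ψ I)
      ... | inj₁ large = same I≢full (suc k) large
      ... | inj₂ small = next I≢full k small
      cases : Dec (I ≡ full) → pushTime (suc N) I ≤ X * (ℕ→ℚ k + ½^ k * Ψ I)
      cases (no I≢full)  = notFull I≢full k
      cases (yes I≡full) = ≤-trans (≤-reflexive (pushTime-full N I≡full)) (0≤* 0≤X (0≤+ (0≤ℕ→ℚ k) (0≤* (0≤½^ k) (0≤Ψ I))))

    broadcast-upper : ∀ L → n ℕ.≤ 2 ℕ.^ suc L → ∀ N s → pushTime N ⁅ s ⁆ ≤ X * ℕ→ℚ (suc (suc (L ℕ.+ D)))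
    broadcast-upper L n≤2^L N s = ≤-trans (push-upper N k (x∈⁅x⁆ s)) (*-monoˡ-≤ 0≤X (≤-trans
      (ℚ.+-monoʳ-≤ (ℕ→ℚ k) (≤-trans (*-monoˡ-≤ (0≤½^ k) Ψ-start) (≤-reflexive (½^*pow2 k))))
      (≤-reflexive (trans (ℚ.+-comm (ℕ→ℚ k) 1ℚ) (sym (ℕ→ℚ-suc k))))))
      where
      -- The index for which 2^k bounds the initial `Ψ`, so that `½^ k * Ψ` is at most 1.
      k = suc (L ℕ.+ D)
      Ψ-start : Ψ ⁅ s ⁆ ≤ pow2 k
      Ψ-start = ≤-trans (Ψ≤ (x∈⁅x⁆ s)) (≤-trans (*-monoʳ-≤ (0≤ℕ→ℚ (2 ℕ.^ D)) (ℕ→ℚ-mono-≤ {n} {2 ℕ.^ suc L} n≤2^L))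
        (≤-reflexive (trans (sym (ℕ→ℚ-* (2 ℕ.^ suc L) (2 ℕ.^ D))) (cong ℕ→ℚ (sym (ℕ.^-distribˡ-+-* 2 (suc L) D))))))

-- The exponential series and logarithms

reciprocal-inverse : ∀ m .{{_ : ℕ.NonZero m}} → (ℤ.+ 1 / m) * ℕ→ℚ m ≡ 1ℚ
reciprocal-inverse (suc k) = 1/suc-inverse k

0≤reciprocal : ∀ m .{{_ : ℕ.NonZero m}} → 0ℚ ≤ ℤ.+ 1 / m
0≤reciprocal (suc k) = 0≤1/suc k

0≤^ : ∀ {p} → 0ℚ ≤ p → ∀ k → 0ℚ ≤ p ^ℚ k
0≤^ 0≤p zero    = 0≤1
0≤^ 0≤p (suc k) = 0≤* 0≤p (0≤^ 0≤p k)

^-mono-≤ : ∀ {p q} → 0ℚ ≤ p → p ≤ q → ∀ k → p ^ℚ k ≤ q ^ℚ k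
^-mono-≤ 0≤p p≤q zero    = ≤-refl
^-mono-≤ 0≤p p≤q (suc k) = ≤-trans (*-monoʳ-≤ (0≤^ 0≤p k) p≤q) (*-monoˡ-≤ (≤-trans 0≤p p≤q) (^-mono-≤ 0≤p p≤q k))

ℕ→ℚ-^ : ∀ m k → ℕ→ℚ (m ℕ.^ k) ≡ ℕ→ℚ m ^ℚ k
ℕ→ℚ-^ m zero    = refl
ℕ→ℚ-^ m (suc k) = trans (ℕ→ℚ-* m (m ℕ.^ k)) (cong (ℕ→ℚ m *_) (ℕ→ℚ-^ m k))

-- Each factor of k! is at most `m`. The base stays fixed during the induction on `k`; the case k =
-- m is the one needed.
2^k*k!≤[2m]^k : ∀ {k m} → k ℕ.≤ m → 2 ℕ.^ k ℕ.* k ! ℕ.≤ (2 ℕ.* m) ℕ.^ k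
2^k*k!≤[2m]^k {zero}      _   = ℕ.≤-refl
2^k*k!≤[2m]^k {suc k} {m} k<m = ℕ.≤-trans (ℕ.≤-reflexive (ℕ.[m*n]*[o*p]≡[m*o]*[n*p] 2 (2 ℕ.^ k) (suc k) (k !)))
  (ℕ.*-mono-≤ (ℕ.*-monoʳ-≤ 2 k<m) (2^k*k!≤[2m]^k (ℕ.<⇒≤ k<m)))

term≤sumℚ : ∀ {A : Set} {f : A → ℚ} → (∀ x → 0ℚ ≤ f x) → ∀ {x xs} → x ∈ xs → f x ≤ sumℚ (List.map f xs)
term≤sumℚ {f = f} 0≤f {xs = _ ∷ xs} (here refl)      = p≤p+q (sumℚ-nonneg {F = f} 0≤f xs)
term≤sumℚ {f = f} 0≤f {xs = y ∷ xs} (there x∈xs) = ≤-trans (term≤sumℚ {f = f} 0≤f x∈xs) (≤-by (f y) (0≤f y) (ℚ.+-comm (f y) (sumℚ (List.map f xs))))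

-- e^(2m) ≥ (2m)^m / m! ≥ 2^m
log-upper : ∀ m n q → 0ℚ ≤ q → n ℕ.≤ 2 ℕ.^ m → exp q ᵣ< ℕ→ℚ n → q ≤ ℕ→ℚ (2 ℕ.* m)
log-upper m n q 0≤q n≤2^m (e , e<n , sums≤e) = decide (q ℚ.≤? ℕ→ℚ (2 ℕ.* m))
  where
  term : ℕ → ℚ
  term k = (q ^ℚ k) * ((ℤ.+ 1 / (k !)) {{k !≢0}})
  0≤term : ∀ k → 0ℚ ≤ term k
  0≤term k = 0≤* (0≤^ 0≤q k) (0≤reciprocal (k !) {{k !≢0}})
  cancel : ∀ p r s → p * s * r ≡ p * (r * s)
  cancel = solve-∀ ring
  2^m≤term : ℕ→ℚ (2 ℕ.* m) ≤ q → ℕ→ℚ (2 ℕ.^ m) ≤ term m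
  2^m≤term 2m≤q = begin
    ℕ→ℚ (2 ℕ.^ m)                                ≡⟨ sym (trans (cong (_* r) (ℕ→ℚ-* (2 ℕ.^ m) (m !))) (trans (cancel (ℕ→ℚ (2 ℕ.^ m)) r (ℕ→ℚ (m !)))
                                                      (trans (cong (ℕ→ℚ (2 ℕ.^ m) *_) (reciprocal-inverse (m !) {{m !≢0}}))
                                                        (ℚ.*-identityʳ (ℕ→ℚ (2 ℕ.^ m)))))) ⟩
    ℕ→ℚ (2 ℕ.^ m ℕ.* m !) * r                    ≤⟨ *-monoʳ-≤ 0≤r (ℕ→ℚ-mono-≤ {2 ℕ.^ m ℕ.* m !} {(2 ℕ.* m) ℕ.^ m} (2^k*k!≤[2m]^k {m} ℕ.≤-refl)) ⟩
    ℕ→ℚ ((2 ℕ.* m) ℕ.^ m) * r                    ≡⟨ cong (_* r) (ℕ→ℚ-^ (2 ℕ.* m) m) ⟩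
    ℕ→ℚ (2 ℕ.* m) ^ℚ m * r                       ≤⟨ *-monoʳ-≤ 0≤r (^-mono-≤ (0≤ℕ→ℚ (2 ℕ.* m)) 2m≤q m) ⟩
    term m                                       ∎
    where
    open ℚ.≤-Reasoning
    r = (ℤ.+ 1 / (m !)) {{m !≢0}}
    0≤r = 0≤reciprocal (m !) {{m !≢0}}
  decide : Dec (q ≤ ℕ→ℚ (2 ℕ.* m)) → q ≤ ℕ→ℚ (2 ℕ.* m)
  decide (yes q≤2m) = q≤2m
  decide (no q≰2m)  = contradiction e<n (λ e<n → ℚ.<-irrefl refl (ℚ.<-≤-trans e<n (≤-trans (ℕ→ℚ-mono-≤ {n} {2 ℕ.^ m} n≤2^m)
    (≤-trans (2^m≤term (<⇒≤ (ℚ.≰⇒> q≰2m))) (≤-trans (term≤sumℚ 0≤term (∈-upTo⁺ (ℕ.n<1+n m))) (sums≤e (suc m)))))))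

log₂-bracket : ∀ n → 1 ℕ.≤ n → ∃[ L ] (2 ℕ.^ L ℕ.≤ n × n ℕ.< 2 ℕ.^ suc L)
log₂-bracket (suc zero)    _ = 0 , ℕ.≤-refl , ℕ.≤-refl
log₂-bracket (suc (suc n)) _ with log₂-bracket (suc n) (ℕ.s≤s ℕ.z≤n)
... | L , lower , upper with suc (suc n) ℕ.<? 2 ℕ.^ suc L
...   | yes below = L , ℕ.m≤n⇒m≤1+n lower , below
...   | no ¬below = suc L , ℕ.≮⇒≥ ¬below , ℕ.≤-<-trans upper (ℕ.^-monoʳ-< 2 (ℕ.s≤s (ℕ.s≤s ℕ.z≤n)) (ℕ.n<1+n (suc L)))

-- Any C with 24 C < 1/32 would do.
constant : ℚ
constant = 1/suc 999

m≤2^m : ∀ m → m ℕ.≤ 2 ℕ.^ m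
m≤2^m zero    = ℕ.z≤n
m≤2^m (suc m) = ℕ.+-mono-≤ (ℕ.m^n>0 2 m) (ℕ.≤-trans (m≤2^m m) (ℕ.m≤m+n (2 ℕ.^ m) 0))

-- 2 (p β) (L + D) ≤ (p β)² + (L + D)²
product-bound : ∀ {n L D p β} → 0ℚ ≤ n → 0ℚ ≤ L → L ≤ n → p * p ≤ n → β * β ≤ ℕ→ℚ 4 * L →
                p * β * (L + D) ≤ ℕ→ℚ 3 * (n * L) + D * D
product-bound {n} {L} {D} {p} {β} 0≤n 0≤L L≤n p²≤n β²≤4L = ≤-by
  (½ * ((p * β - (L + D)) * (p * β - (L + D))) + ½ * (n * (ℕ→ℚ 4 * L - β * β) + (n - p * p) * (β * β)) + ½ * ((L - D) * (L - D)) + L * (n - L))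
  (0≤+ (0≤+ (0≤+ (0≤* 0≤½ (0≤square (p * β - (L + D))))
    (0≤* 0≤½ (0≤+ (0≤* 0≤n (≤⇒0≤- β²≤4L)) (0≤* (≤⇒0≤- p²≤n) (0≤square β)))))
    (0≤* 0≤½ (0≤square (L - D)))) (0≤* 0≤L (≤⇒0≤- L≤n)))
  (identity n L D p β)
  where
  identity : ∀ n L D p β → ℕ→ℚ 3 * (n * L) + D * D ≡ p * β * (L + D) +
    (½ * ((p * β - (L + D)) * (p * β - (L + D))) + ½ * (n * (ℕ→ℚ 4 * L - β * β) + (n - p * p) * (β * β)) + ½ * ((L - D) * (L - D)) + L * (n - L))
  identity = solve-∀ ring

-- Comparing cover time and broadcast time

module Ratio {n : ℕ} (2≤n : 2 ℕ.≤ n) (G : Graph n) where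
  open Graph G
  open Distance G
  open Walk 2≤n G
  open CoverBounds 2≤n G

  degree≤maxDegree : ∀ u → degree u ℕ.≤ maxDegree
  degree≤maxDegree u = All.lookup (xs≤max 0 (List.map degree (allFin n))) (∈-map⁺ degree (∈-allFin u))

  1≤n : 1 ℕ.≤ n
  1≤n = ℕ.<⇒≤ 2≤n

  1≤maxDegree : 1 ℕ.≤ maxDegree
  1≤maxDegree = ℕ.≤-trans (ℕ→ℚ-cancel-≤ {1} {degree x₀} (≤-trans (1≤deg x₀) (≤-reflexive (sym (deg≡degree x₀))))) (degree≤maxDegree x₀)
    where
    x₀ : Fin n
    x₀ = Fin.fromℕ< 1≤n

  D : ℕ
  D = let u , v , _ = diameter in dist v u

  dist≤D : ∀ v u → dist v u ℕ.≤ D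
  dist≤D v u = let _ , _ , _ , maximal = diameter in maximal u v

  1≤D : 1 ℕ.≤ D
  1≤D = let u , v , u≢v , _ = diameter in ℕ.n≢0⇒n>0 (λ d≡0 → u≢v (dist≡0⇒≡ v u d≡0))

  module _ (L : ℕ) (1≤L : 1 ℕ.≤ L) (2^L≤n : 2 ℕ.^ L ℕ.≤ n) (n<2^L+1 : n ℕ.< 2 ℕ.^ suc L) where

    nq Lq Dq Δq S : ℚ
    nq = ℕ→ℚ n
    Lq = ℕ→ℚ L
    Dq = ℕ→ℚ D
    Δq = ℕ→ℚ maxDegree
    S = Lq + Dq

    0≤nL : 0ℚ ≤ nq * Lq
    0≤nL = 0≤* (0≤ℕ→ℚ n) (0≤ℕ→ℚ L)

    0<nL : 0ℚ < nq * Lq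
    0<nL = 0<* (0<ℕ→ℚ 1≤n) (0<ℕ→ℚ 1≤L)

    0<D² : 0ℚ < Dq * Dq
    0<D² = 0<* (0<ℕ→ℚ 1≤D) (0<ℕ→ℚ 1≤D)

    -- The numerator witness for the quotient, the same for every `q`. The factor 6 is that of
    -- `broadcastBound`, which is 6Δ(L + D), and the bracket is the right side of `product-bound`.
    coverBound : ℚ
    coverBound = ℕ→ℚ 6 * constant * (ℕ→ℚ 3 * (nq * Lq) + Dq * Dq)

    broadcastBound : ℚ
    broadcastBound = (Δq + Δq) * (ℕ→ℚ 3 * S)

    0≤broadcastBound : 0ℚ ≤ broadcastBound
    0≤broadcastBound = 0≤* (0≤+ (0≤ℕ→ℚ maxDegree) (0≤ℕ→ℚ maxDegree)) (0≤* (0≤ℕ→ℚ 3) (0≤+ (0≤ℕ→ℚ L) (0≤ℕ→ℚ D)))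

    0≤coverBound : 0ℚ ≤ coverBound
    0≤coverBound = 0≤* (ℚ.nonNegative⁻¹ (ℕ→ℚ 6 * constant)) (0≤+ (0≤* (0≤ℕ→ℚ 3) 0≤nL) (0≤square Dq))

    -- For D² ≤ nL the bracket in `coverBound` is at most 4nL, while the cover time is at least
    -- nL/32. The positive gap provides the strict inequality that a lower cut demands.
    surplus : ℚ
    surplus = ⅛ * (½ * ½) - ℕ→ℚ 24 * constant

    strict : ∀ {p e} r → 0ℚ < r → e ≡ p + r → p < e
    strict {p} r 0<r e≡ = subst₂ _<_ (ℚ.+-identityʳ p) (sym e≡) (ℚ.+-monoʳ-< p 0<r)

    coverBound<nlogn : ∀ {E} → Dq * Dq ≤ nq * Lq → (⅛ * nq) * (½ * Lq) ≤ E + E → coverBound < E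
    coverBound<nlogn {E} D²≤nL le =
      strict (surplus * (nq * Lq) + (ℕ→ℚ 6 * constant * (nq * Lq - Dq * Dq) + ½ * ((E + E) - (⅛ * nq) * (½ * Lq))))
        (ℚ.+-mono-<-≤ (0<* (ℚ.positive⁻¹ surplus) 0<nL) (0≤+ (0≤* (ℚ.nonNegative⁻¹ (ℕ→ℚ 6 * constant)) (≤⇒0≤- D²≤nL)) (0≤* 0≤½ (≤⇒0≤- le))))
        (identity constant nq Lq Dq E)
      where
      identity : ∀ c n L D E → E ≡ ℕ→ℚ 6 * c * (ℕ→ℚ 3 * (n * L) + D * D) +
        ((⅛ * (½ * ½) - ℕ→ℚ 24 * c) * (n * L) + (ℕ→ℚ 6 * c * (n * L - D * D) + ½ * ((E + E) - (⅛ * n) * (½ * L))))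
      identity = solve-∀ ring

    -- Here D² dominates, so `coverBound` is at most 24 `constant` D², against a cover time of at
    -- least D²/2.
    coverBound<D² : ∀ {E} → nq * Lq ≤ Dq * Dq → Dq * Dq ≤ E + E → coverBound < E
    coverBound<D² {E} nL≤D² le =
      strict ((½ - ℕ→ℚ 24 * constant) * (Dq * Dq) + (ℕ→ℚ 18 * constant * (Dq * Dq - nq * Lq) + ½ * ((E + E) - Dq * Dq)))
        (ℚ.+-mono-<-≤ (0<* (ℚ.positive⁻¹ (½ - ℕ→ℚ 24 * constant)) 0<D²)
          (0≤+ (0≤* (ℚ.nonNegative⁻¹ (ℕ→ℚ 18 * constant)) (≤⇒0≤- nL≤D²)) (0≤* 0≤½ (≤⇒0≤- le))))
        (identity constant nq Lq Dq E)
      where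
      identity : ∀ c n L D E → E ≡ ℕ→ℚ 6 * c * (ℕ→ℚ 3 * (n * L) + D * D) +
        ((½ - ℕ→ℚ 24 * c) * (D * D) + (ℕ→ℚ 18 * c * (D * D - n * L) + ½ * ((E + E) - D * D)))
      identity = solve-∀ ring

    coverBound<COV : coverBound <ᵣ COV G
    coverBound<COV = cases (ℚ.≤-total (Dq * Dq) (nq * Lq))
      where
      cases : Dq * Dq ≤ nq * Lq ⊎ nq * Lq ≤ Dq * Dq → coverBound <ᵣ COV G
      cases (inj₁ D²≤nL) =
        let s , N , le = cover-nlogn 1≤L 2^L≤n
        in s , N , coverBound<nlogn D²≤nL le
      cases (inj₂ nL≤D²) =
        let u , v , u≢v , _ = diameter
            s , N , le = cover-distance u v u≢v
        in s , N , coverBound<D² nL≤D² le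

    RBA<broadcastBound : E[RBA] G ᵣ< broadcastBound
    RBA<broadcastBound s = go maxDegree refl
      where
      -- `L` and `D` are at least 1, which absorbs the additive 2 and leaves room for strictness in
      -- the upper cut.
      2+L+D<3[L+D] : suc (suc (L ℕ.+ D)) ℕ.< 3 ℕ.* (L ℕ.+ D)
      2+L+D<3[L+D] = ℕ.≤-trans (ℕ.≤-reflexive (ℕ.+-comm 3 (L ℕ.+ D))) (ℕ.+-monoʳ-≤ (L ℕ.+ D)
        (ℕ.≤-trans (ℕ.m≤n+m 3 1) (ℕ.*-monoʳ-≤ 2 (ℕ.+-mono-≤ 1≤L 1≤D))))
      go : ∀ Δ → Δ ≡ maxDegree → expectedTime (pushStep G) allInformed? ⁅ s ⁆ ᵣ< broadcastBound
      go zero    Δ≡ = contradiction (subst (1 ℕ.≤_) (sym Δ≡) 1≤maxDegree) λ ()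
      go (suc Δ-1) Δ≡ = X * ℕ→ℚ (suc (suc (L ℕ.+ D))) ,
        subst (X * ℕ→ℚ (suc (suc (L ℕ.+ D))) <_)
          (cong₂ _*_ (cong₂ _+_ (cong ℕ→ℚ Δ≡) (cong ℕ→ℚ Δ≡)) (trans (ℕ→ℚ-* 3 (L ℕ.+ D)) (cong (ℕ→ℚ 3 *_) (ℕ→ℚ-+ L D))))
          (ℚ.*-monoʳ-<-pos X {{ℚ.positive (ℚ.<-≤-trans 0<1 1≤X)}} (ℕ→ℚ-mono-< {suc (suc (L ℕ.+ D))} {3 ℕ.* (L ℕ.+ D)} 2+L+D<3[L+D])) ,
        λ N → broadcast-upper L (ℕ.<⇒≤ n<2^L+1) N s
        where
        open Push 2≤n G Δ-1 (λ u → subst (degree u ℕ.≤_) (sym Δ≡) (degree≤maxDegree u)) using (module Bound)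
        open Bound D dist≤D

    log-bound : ∀ {β} → exp (β * β) ᵣ< ℕ→ℚ n → β * β ≤ ℕ→ℚ 4 * Lq
    log-bound {β} exp<n = ≤-trans (log-upper (suc L) n (β * β) (0≤square β) (ℕ.<⇒≤ n<2^L+1) exp<n)
      (≤-trans (ℕ→ℚ-mono-≤ {2 ℕ.* suc L} {4 ℕ.* L} 2[1+L]≤4L) (≤-reflexive (ℕ→ℚ-* 4 L)))
      where
      2[1+L]≤4L : 2 ℕ.* suc L ℕ.≤ 4 ℕ.* L
      2[1+L]≤4L = ℕ.≤-trans (ℕ.*-monoʳ-≤ 2 (ℕ.+-mono-≤ 1≤L (ℕ.m≤m+n L 0))) (ℕ.≤-reflexive (sym (ℕ.*-assoc 2 2 L)))

    -- The maximum degree in `broadcastBound` cancels the one in the denominator of `r`: r Δ ≤ r δ ≤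
    -- p, where p approximates the root of n from below. What is left is `product-bound`.
    product-below : ∀ {q c r p δ β} → 0ℚ ≤ r → c < constant → Δq < δ → r * δ ≤ p → p * p < nq →
      0ℚ ≤ β → exp (β * β) ᵣ< ℕ→ℚ n → q ≤ c * r * β → q * broadcastBound ≤ coverBound
    product-below {q} {c} {r} {p} {δ} {β} 0≤r c<C Δ<δ rδ≤p p²<n 0≤β exp<n q≤ = begin
      q * broadcastBound                                   ≤⟨ *-monoʳ-≤ 0≤broadcastBound (≤-trans q≤ (*-monoʳ-≤ 0≤β (*-monoʳ-≤ 0≤r (<⇒≤ c<C)))) ⟩
      constant * r * β * broadcastBound                    ≡⟨ identity constant r β Δq S ⟩
      ℕ→ℚ 6 * constant * (r * Δq * (β * S))                ≤⟨ *-monoˡ-≤ 0≤6C (*-monoʳ-≤ 0≤βS (≤-trans (*-monoˡ-≤ 0≤r (<⇒≤ Δ<δ)) rδ≤p)) ⟩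
      ℕ→ℚ 6 * constant * (p * (β * S))                     ≡⟨ cong (ℕ→ℚ 6 * constant *_) (sym (ℚ.*-assoc p β S)) ⟩
      ℕ→ℚ 6 * constant * (p * β * S)                       ≤⟨ *-monoˡ-≤ 0≤6C (product-bound {nq} {Lq} {Dq} {p} {β}
                                                                (0≤ℕ→ℚ n) (0≤ℕ→ℚ L) L≤n (<⇒≤ p²<n) (log-bound {β} exp<n)) ⟩
      coverBound                                           ∎
      where
      open ℚ.≤-Reasoning
      0≤6C : 0ℚ ≤ ℕ→ℚ 6 * constant
      0≤6C = ℚ.nonNegative⁻¹ (ℕ→ℚ 6 * constant)
      0≤βS : 0ℚ ≤ β * S
      0≤βS = 0≤* 0≤β (0≤+ (0≤ℕ→ℚ L) (0≤ℕ→ℚ D))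
      L≤n : Lq ≤ nq
      L≤n = ℕ→ℚ-mono-≤ {L} {n} (ℕ.≤-trans (m≤2^m L) 2^L≤n)
      identity : ∀ c r β d s → c * r * β * ((d + d) * (ℕ→ℚ 3 * s)) ≡ ℕ→ℚ 6 * c * (r * d * (β * s))
      identity = solve-∀ ring

    below⇒≤ : ∀ q → q <ᵣ fromℚ constant *ᵣ ((√ (fromℕ n)) ÷ᵣ fromℕ maxDegree) *ᵣ (√ (log n)) → q * broadcastBound ≤ coverBound
    below⇒≤ q (inj₁ q<0) = ≤-trans (*-monoʳ-≤ 0≤broadcastBound (<⇒≤ q<0)) (≤-trans (≤-reflexive (ℚ.*-zeroˡ broadcastBound)) 0≤coverBound)
    -- Lower cuts of products, roots and the logarithm also contain negative rationals. This and the
    -- next three clauses exclude them by the sign of the approximants or squares.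
    below⇒≤ q (inj₂ (α , β , 0≤α , 0≤β , inj₁ α<0 , _)) = contradiction (ℚ.<-≤-trans α<0 0≤α) (ℚ.<-irrefl refl)
    below⇒≤ q (inj₂ (α , β , 0≤α , 0≤β , _ , inj₁ β<0 , _)) = contradiction (ℚ.<-≤-trans β<0 0≤β) (ℚ.<-irrefl refl)
    below⇒≤ q (inj₂ (α , β , 0≤α , 0≤β , _ , inj₂ (inj₁ β²<0) , _)) = contradiction (ℚ.<-≤-trans β²<0 (0≤square β)) (ℚ.<-irrefl refl)
    below⇒≤ q (inj₂ (α , β , 0≤α , 0≤β , inj₂ (c , r , 0≤c , 0≤r , c<C , (p , δ , inj₁ p<0 , Δ<δ , rδ≤p) , α≤cr) , _)) =
      contradiction (ℚ.<-≤-trans (ℚ.≤-<-trans rδ≤p p<0) (0≤* 0≤r (≤-trans (0≤ℕ→ℚ maxDegree) (<⇒≤ Δ<δ)))) (ℚ.<-irrefl refl)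
    below⇒≤ q (inj₂ (α , β , 0≤α , 0≤β , inj₂ (c , r , 0≤c , 0≤r , c<C , (p , δ , inj₂ p²<n , Δ<δ , rδ≤p) , α≤cr) , inj₂ (inj₂ exp<n) , q≤αβ)) =
      product-below 0≤r c<C Δ<δ rδ≤p p²<n 0≤β exp<n (≤-trans q≤αβ (*-monoʳ-≤ 0≤β α≤cr))

    𝓡-lower : 𝓡 G ≥ᵣ fromℚ constant *ᵣ ((√ (fromℕ n)) ÷ᵣ fromℕ maxDegree) *ᵣ (√ (log n))
    𝓡-lower q q<rhs = coverBound , broadcastBound , coverBound<COV , RBA<broadcastBound , below⇒≤ q q<rhs

proposition4p4 : ∃[ C ] (0ℚ ℚ.< C × (∀ (n : ℕ) → 2 ℕ.≤ n → (G : Graph n) → 𝓡 G ≥ᵣ fromℚ C *ᵣ ((√ (fromℕ n)) ÷ᵣ fromℕ (Graph.maxDegree G)) *ᵣ (√ (log n))))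
proposition4p4 = constant , ℚ.positive⁻¹ constant , λ n 2≤n G →
  let L , 2^L≤n , n<2^L+1 = log₂-bracket n (ℕ.<⇒≤ 2≤n)
  in Ratio.𝓡-lower 2≤n G L (1≤L 2≤n n<2^L+1) 2^L≤n n<2^L+1
  where
  1≤L : ∀ {n L} → 2 ℕ.≤ n → n ℕ.< 2 ℕ.^ suc L → 1 ℕ.≤ L
  1≤L {L = zero}  2≤n n<2 = contradiction (ℕ.≤-<-trans 2≤n n<2) (ℕ.<-irrefl refl)
  1≤L {L = suc L} _   _   = ℕ.s≤s ℕ.z≤n
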